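{- Let ${\bf u}\in\mathcal A^{\mathbb N}$ be a fixed point of a primitive morphism $\varphi$ over a binary alphabet $\mathcal A$. If $D({\bf u})<+\infty$, then $D({\bf u})=0$ or ${\bf u}$ is periodic.
   Context: A morphism $\varphi:\mathcal A^*\to\mathcal A^*$ is primitive if there is $k$ such that every letter occurs in $\varphi^k(a)$ for every letter $a$; ${\bf u}$ is a fixed point if $\varphi({\bf u})={\bf u}$. Palindromic defect: for a finite word $w$ of length $n$, $D(w)=n+1-$(number of distinct palindromic factors of $w$, including the empty word), and $D({\bf u})=\sup D(w)$ over factors $w$ of ${\bf u}$. -}

module Defs where

open import Algebra.Morphism.Structures using (module MonoidMorphisms)
open import Data.Fin.Base using (Fin)
open import Data.Fin.Properties using (_≟_)
open import Data.List.Base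
  using (List; []; [_]; length; reverse; concatMap; inits; tails; filter;
         deduplicate; applyUpTo; ++-[]-rawMonoid)
open import Data.List.Membership.Propositional using (_∈_)
open import Data.List.Properties using (≡-dec)
open import Data.Nat.Base using (ℕ; suc; _+_; _∸_; _≤_; _<_)
open import Data.Product.Base using (_×_; ∃; ∃₂)
import Function.Endo.Propositional as Endo
open import Relation.Binary.Definitions using (DecidableEquality)
open import Relation.Binary.PropositionalEquality.Core using (_≡_)
open import Relation.Nullary.Decidable.Core using (Dec)

-- The alphabet with k letters is Fin k.

Word : ℕ → Set
Word k = List (Fin k)

InfWord : ℕ → Set
InfWord k = ℕ → Fin k

private
  variable
    k : ℕ

infix 4 _≟ʷ_
_≟ʷ_ : DecidableEquality (Word k)
_≟ʷ_ = ≡-dec _≟_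

-- factorAt u i n = u(i) u(i+1) … u(i+n-1)
factorAt : InfWord k → ℕ → ℕ → Word k
factorAt u i n = applyUpTo (λ j → u (i + j)) n

prefix : InfWord k → ℕ → Word k
prefix u n = factorAt u 0 n

_IsFactorOf_ : Word k → InfWord k → Set
w IsFactorOf u = ∃₂ λ i n → w ≡ factorAt u i n

IsMorphism : (Word k → Word k) → Set
IsMorphism {k} φ = IsMonoidHomomorphism φ
  where open MonoidMorphisms (++-[]-rawMonoid (Fin k)) (++-[]-rawMonoid (Fin k))

IsPrimitive : (Word k → Word k) → Set
IsPrimitive {k} φ = ∃ λ m → ∀ (a b : Fin k) → b ∈ (φ ^ m) [ a ]
  where open Endo (Word k) using (_^_)

-- φ(u) = φ(u₀)φ(u₁)φ(u₂)⋯ is the infinite word v: each φ(u₀⋯uₙ₋₁) is a prefix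
-- of v, and these prefixes are arbitrarily long, so that they determine v.
MapsTo : (Word k → Word k) → InfWord k → InfWord k → Set
MapsTo φ u v =
  (∀ n → φ (prefix u n) ≡ prefix v (length (φ (prefix u n)))) ×
  (∀ m → ∃ λ n → m ≤ length (φ (prefix u n)))

IsFixedPoint : (Word k → Word k) → InfWord k → Set
IsFixedPoint φ u = MapsTo φ u u

IsPalindrome : Word k → Set
IsPalindrome w = reverse w ≡ w

isPalindrome? : (w : Word k) → Dec (IsPalindrome w)
isPalindrome? w = reverse w ≟ʷ w

-- All factors of w, including the empty word, possibly with repetitions.
factors : Word k → List (Word k)
factors w = concatMap inits (tails w)

palindromicFactors : Word k → List (Word k)
palindromicFactors w = deduplicate _≟ʷ_ (filter isPalindrome? (factors w))

-- A word of length n has at most n + 1 distinct palindromic factors, so the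
-- subtraction is never truncated.
defect : Word k → ℕ
defect w = suc (length w) ∸ length (palindromicFactors w)

IsDefectBound : InfWord k → ℕ → Set
IsDefectBound u N = ∀ w → w IsFactorOf u → defect w ≤ N

-- D(u) = d, for the supremum D(u) ∈ ℕ ∪ {+∞} of the defects of the factors.
HasDefect : InfWord k → ℕ → Set
HasDefect u d = IsDefectBound u d × (∀ N → IsDefectBound u N → d ≤ N)

-- D(u) < +∞.  Boundedness, rather than ∃ (HasDefect u): a bounded set of
-- naturals need not have a supremum constructively.
HasFiniteDefect : InfWord k → Set
HasFiniteDefect u = ∃ λ N → IsDefectBound u N

IsPeriodic : InfWord k → Set
IsPeriodic u = ∃ λ p → 0 < p × (∀ n → u (n + p) ≡ u n)

{-# OPTIONS --safe #-}
module Submission where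

-- Replace φ by a power π such that every π(a) contains both letters.  If π(01) =
-- π(10), then u is periodic.  Otherwise D(u) = 0, as follows.  Identify every
-- word with its mirror image in the Rauzy graph of order n and drop the loops.
-- u has defect 0 iff all these graphs are trees, and finite defect makes those of
-- large order trees.  Passing from order n to n + 1, a cycle can only be created
-- at a strong non-palindromic w, one with awb a factor for all letters a and b;
-- conversely such a w of length n yields a 4-cycle of order n + 1.  So it suffices
-- to exclude strong non-palindromic factors, knowing that there are no long ones.
-- With v the longest common prefix of π(01) and π(10), and v′ their longest common
-- suffix, Φ(x) = v′π(x)v maps strong factors to longer strong factors.  If w is
-- strong, then x = Φᵏ(w) and Φ(x) are thus palindromes for some k, and this single
-- coincidence, read letter by letter, forces Φ to commute with reversal.  As Φ is
-- injective, w is itself a palindrome.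

open import Defs
open import Algebra.Bundles using (CommutativeRing)
open import Algebra.Morphism.Structures using (module MonoidMorphisms)
open import Data.Bool.Base using (Bool; true; false; _∧_; _xor_; if_then_else_)
open import Data.Bool.Properties
  using (xor-comm; xor-same; xor-identityʳ; xor-∧-commutativeRing) renaming (_≟_ to _≟ᵇ_)
open import Data.Empty using (⊥-elim)
open import Data.Fin.Base using (Fin; zero; suc)
import Data.Fin.Properties as Fin
open import Data.List.Base
  using (List; []; _∷_; [_]; _++_; length; reverse; applyUpTo; applyDownFrom; inits; tails; filter)
open import Data.List.Membership.Propositional using (_∈_; _∉_; find; lose)
open import Data.List.Membership.Propositional.Properties
  using (∈-++⁺ˡ; ∈-++⁺ʳ; ∈-++⁻; ∈-∃++; ∈-map⁺; ∈-map⁻; ∈-concatMap⁺; ∈-concatMap⁻;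
         ∈-filter⁺; ∈-filter⁻; ∈-deduplicate⁺; ∈-deduplicate⁻)
open import Data.List.Properties
  using (++-assoc; ++-identityʳ; ++-cancelˡ; ++-cancelʳ; length-++; length-applyUpTo; length-reverse;
         reverse-++; reverse-involutive; reverse-injective; reverse-applyUpTo;
         ∷-injective; ∷-injectiveˡ; ∷-injectiveʳ)
import Data.List.Relation.Unary.All as All
open import Data.List.Relation.Unary.All.Properties using (¬Any⇒All¬)
open import Data.List.Relation.Unary.AllPairs using ([]; _∷_)
open import Data.List.Relation.Unary.Any using (here; there)
import Data.List.Relation.Unary.Unique.DecPropositional.Properties as Unique
open import Data.List.Relation.Unary.Unique.Propositional using (Unique)
open import Data.Nat.Base using (ℕ; zero; suc; _+_; _∸_; _≤_; _<_; z≤n; s≤s; s≤s⁻¹)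
open import Data.Nat.Properties
open import Data.Nat.Tactic.RingSolver using (solve-∀)
open import Data.Product.Base using (_×_; _,_; ∃; ∃₂; proj₁; proj₂)
open import Data.Sum.Base using (_⊎_; inj₁; inj₂; [_,_]′)
open import Function.Base using (_∘_)
import Function.Endo.Propositional as Endo
open import Relation.Binary.Definitions using (tri<; tri≈; tri>)
open import Relation.Binary.PropositionalEquality
  using (_≡_; _≢_; refl; sym; trans; cong; cong₂; subst; module ≡-Reasoning)
open import Relation.Nullary.Decidable
  using (Dec; yes; no; does; dec-true; dec-false; map′; _×-dec_; _⊎-dec_; ¬?; decidable-stable)
open import Relation.Nullary.Negation using (¬_; contradiction)

-- No graph is ever built. The word itself is a walk whose positions are visits of vertices, and the
-- graph so walked is a tree, up to loops, iff every other edge is a bridge, that is, iff it is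
-- crossed an even number of times between any two visits of one vertex. Being a tree thus becomes a
-- statement on parities, and passing from one order to the next means rewriting the crossings of
-- one edge as a sum mod 2 of counts already controlled. Defect enters through complete returns:
-- between consecutive visits of a vertex, a walk in a tree must come back over the edge by which it
-- left, and repeating this argument peels one letter off both ends until the return is seen to be a
-- palindrome. The constructive obstacle is that neither the length from which every prefix gains a
-- palindrome nor the set of extensions of a block is available as data. Both are used only under
-- double negation, which suffices because the goals, an equality of two parities and
-- `defect w ≤ 0`, are decidable.

-- Booleans and parities of counts over an interval.

does-cong : ∀ {P Q : Set} (p? : Dec P) (q? : Dec Q) → (P → Q) → (Q → P) → does p? ≡ does q?
does-cong (yes p) q? f g = sym (dec-true q? (f p))
does-cong (no ¬p) q? f g = sym (dec-false q? (λ q → ¬p (g q)))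

does≡ : ∀ {P Q R : Set} (p? : Dec P) (q? : Dec Q) (r? : Dec R) → (P → Q) → (Q → P) → ¬ R →
        does p? ≡ does q? xor does r?
does≡ p? q? r? f g ¬r = trans (does-cong p? q? f g)
  (sym (trans (cong (does q? xor_) (dec-false r? ¬r)) (xor-identityʳ (does q?))))

does-xor : ∀ {P Q R : Set} (p? : Dec P) (q? : Dec Q) (r? : Dec R) →
           (P → Q × ¬ R ⊎ ¬ Q × R) → (Q → ¬ R → P) → (¬ Q → R → P) → does p? ≡ does q? xor does r?
does-xor p? (yes q) (yes r) f g h = dec-false p? λ p → [ (λ x → proj₂ x r) , (λ x → proj₁ x q) ]′ (f p)
does-xor p? (yes q) (no ¬r) f g h = dec-true p? (g q ¬r)
does-xor p? (no ¬q) (yes r) f g h = dec-true p? (h ¬q r)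
does-xor p? (no ¬q) (no ¬r) f g h = dec-false p? λ p → [ (λ x → ¬q (proj₁ x)) , (λ x → ¬r (proj₂ x)) ]′ (f p)

does⁻¹ : ∀ {P : Set} (p? : Dec P) → does p? ≡ true → P
does⁻¹ (yes p) _ = p

does⁻¹-false : ∀ {P : Set} (p? : Dec P) → does p? ≡ false → ¬ P
does⁻¹-false (no ¬p) _ = ¬p

parity : (ℕ → Bool) → ℕ → Bool
parity f zero    = false
parity f (suc i) = parity f i xor f i

parity-cong : ∀ {f g} → (∀ k → f k ≡ g k) → ∀ i → parity f i ≡ parity g i
parity-cong f≗g zero    = refl
parity-cong f≗g (suc i) = cong₂ _xor_ (parity-cong f≗g i) (f≗g i)

xor-interchange : ∀ a b c d → (a xor b) xor (c xor d) ≡ (a xor c) xor (b xor d)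
xor-interchange = interchange
  where open import Algebra.Properties.CommutativeSemigroup
               (CommutativeRing.+-commutativeSemigroup xor-∧-commutativeRing)

parity-xor : ∀ (f g : ℕ → Bool) i → parity (λ k → f k xor g k) i ≡ parity f i xor parity g i
parity-xor f g zero    = refl
parity-xor f g (suc i) = trans (cong (_xor (f i xor g i)) (parity-xor f g i))
  (xor-interchange (parity f i) (parity g i) (f i) (g i))

parity-telescope : ∀ (f s : ℕ → Bool) → (∀ k → f k ≡ s k xor s (suc k)) → ∀ i → parity f i ≡ s 0 xor s i
parity-telescope f s h zero    = sym (xor-same (s 0))
parity-telescope f s h (suc i) = begin
  parity f i xor f i                     ≡⟨ cong₂ _xor_ (parity-telescope f s h i) (h i) ⟩
  (s 0 xor s i) xor (s i xor s (suc i))  ≡⟨ cancel (s 0) (s i) _ ⟩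
  s 0 xor s (suc i)                      ∎
  where
  open ≡-Reasoning
  cancel : ∀ a b c → (a xor b) xor (b xor c) ≡ a xor c
  cancel false false c = refl
  cancel false true false = refl
  cancel false true true = refl
  cancel true false c = refl
  cancel true true false = refl
  cancel true true true = refl

parity-false : ∀ f i d → (∀ k → i ≤ k → k < i + d → f k ≡ false) → parity f i ≡ parity f (i + d)
parity-false f i zero    h = cong (parity f) (sym (+-identityʳ i))
parity-false f i (suc d) h = begin
  parity f i
    ≡⟨ parity-false f i d (λ k i≤k k<id → h k i≤k (<-≤-trans k<id (+-monoʳ-≤ i (n≤1+n d)))) ⟩
  parity f (i + d)               ≡⟨ sym (xor-identityʳ _) ⟩
  parity f (i + d) xor false
    ≡⟨ cong (parity f (i + d) xor_) (sym (h (i + d) (m≤m+n i d) (+-monoʳ-< i (n<1+n d)))) ⟩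
  parity f (suc (i + d))         ≡⟨ cong (parity f) (sym (+-suc i d)) ⟩
  parity f (i + suc d)           ∎
  where open ≡-Reasoning

-- Values at mirrored positions cancel in pairs; an interval of odd length leaves its centre over,
-- which therefore has to be `false`.
parity-symmetric : ∀ f i d →
  (∀ k l → i ≤ k → i ≤ l → suc (k + l) ≡ i + (i + d) → f k ≡ f l) →
  (∀ k → i ≤ k → suc (k + k) ≡ i + (i + d) → f k ≡ false) →
  parity f i ≡ parity f (i + d)
parity-symmetric f i zero sy ce = cong (parity f) (sym (+-identityʳ i))
parity-symmetric f i (suc zero) sy ce = begin
  parity f i             ≡⟨ sym (xor-identityʳ _) ⟩
  parity f i xor false   ≡⟨ cong (parity f i xor_) (sym (ce i ≤-refl (eq i))) ⟩
  parity f (suc i)       ≡⟨ cong (parity f) (+-comm 1 i) ⟩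
  parity f (i + 1)       ∎
  where
  open ≡-Reasoning
  eq : ∀ i → suc (i + i) ≡ i + (i + 1)
  eq = solve-∀
parity-symmetric f i (suc (suc d)) sy ce = begin
  parity f i                                ≡⟨ sym (cancel (parity f i) (f i)) ⟩
  parity f (suc i) xor f i
    ≡⟨ cong₂ _xor_ ih (sy i (suc (i + d)) ≤-refl (≤-trans (m≤m+n i d) (n≤1+n _)) (eq₁ i d)) ⟩
  parity f (suc i + d) xor f (suc (i + d))  ≡⟨ cong (parity f) (eq₂ i d) ⟩
  parity f (i + suc (suc d))                ∎
  where
  open ≡-Reasoning
  cancel : ∀ a b → (a xor b) xor b ≡ a
  cancel false false = refl
  cancel false true = refl
  cancel true false = refl
  cancel true true = refl
  eq₁ : ∀ i d → suc (i + suc (i + d)) ≡ i + (i + suc (suc d))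
  eq₁ = solve-∀
  eq₂ : ∀ i d → suc (suc (i + d)) ≡ i + suc (suc d)
  eq₂ = solve-∀
  eq₃ : ∀ i d → suc i + (suc i + d) ≡ i + (i + suc (suc d))
  eq₃ = solve-∀
  ih = parity-symmetric f (suc i) d
    (λ k l i<k i<l e → sy k l (<⇒≤ i<k) (<⇒≤ i<l) (trans e (eq₃ i d)))
    (λ k i<k e → ce k (<⇒≤ i<k) (trans e (eq₃ i d)))

-- Blocks of an infinite word, up to equality and reversal.

module Blocks {a : ℕ} (u : InfWord a) where

  private
    variable
      i j k l n i′ j′ n′ p t : ℕ

  -- A factor of u is represented by its length and the position of an occurrence.
  Eqv Mir Cong : ℕ → ℕ → ℕ → Set
  Eqv i j n = ∀ m → m < n → u (i + m) ≡ u (j + m)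
  Mir i j n = ∀ m m′ → suc (m + m′) ≡ n → u (i + m) ≡ u (j + m′)
  Cong i j n = Eqv i j n ⊎ Mir i j n

  Eqv-refl : Eqv i i n
  Eqv-refl m _ = refl

  Eqv-sym : Eqv i j n → Eqv j i n
  Eqv-sym h m m<n = sym (h m m<n)

  Eqv-trans : Eqv i j n → Eqv j k n → Eqv i k n
  Eqv-trans g h m m<n = trans (g m m<n) (h m m<n)

  Mir-sym : Mir i j n → Mir j i n
  Mir-sym h m m′ e = sym (h m′ m (trans (cong suc (+-comm m′ m)) e))

  Eqv-Mir : Eqv i j n → Mir j k n → Mir i k n
  Eqv-Mir g h m m′ e = trans (g m (subst (suc m ≤_) e (s≤s (m≤m+n m m′)))) (h m m′ e)

  Mir-Eqv : Mir i j n → Eqv j k n → Mir i k n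
  Mir-Eqv g h = Mir-sym (Eqv-Mir (Eqv-sym h) (Mir-sym g))

  Mir-Mir : Mir i j n → Mir j k n → Eqv i k n
  Mir-Mir g h m m<n with m≤n⇒∃[o]m+o≡n m<n
  ... | o , e = trans (g m o e) (h o m (trans (cong suc (+-comm o m)) e))

  Cong-refl : Cong i i n
  Cong-refl = inj₁ Eqv-refl

  Cong-sym : Cong i j n → Cong j i n
  Cong-sym (inj₁ x) = inj₁ (Eqv-sym x)
  Cong-sym (inj₂ x) = inj₂ (Mir-sym x)

  Cong-trans : Cong i j n → Cong j k n → Cong i k n
  Cong-trans (inj₁ x) (inj₁ y) = inj₁ (Eqv-trans x y)
  Cong-trans (inj₁ x) (inj₂ y) = inj₂ (Eqv-Mir x y)
  Cong-trans (inj₂ x) (inj₁ y) = inj₂ (Mir-Eqv x y)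
  Cong-trans (inj₂ x) (inj₂ y) = inj₁ (Mir-Mir x y)

  Eqv-init : n′ ≤ n → Eqv i j n → Eqv i j n′
  Eqv-init n′≤n h m m<n′ = h m (<-≤-trans m<n′ n′≤n)

  Eqv-drop : ∀ o → o + n′ ≤ n → Eqv i j n → Eqv (i + o) (j + o) n′
  Eqv-drop {i = i} {j} o le h m m<n′ =
    trans (cong u (+-assoc i o m))
      (trans (h (o + m) (<-≤-trans (+-monoʳ-< o m<n′) le)) (cong u (sym (+-assoc j o m))))

  Eqv-tail : Eqv i j (suc n) → Eqv (suc i) (suc j) n
  Eqv-tail {i} {j} h m m<n = trans (cong u (sym (+-suc i m))) (trans (h (suc m) (s≤s m<n)) (cong u (+-suc j m)))

  -- Reflecting a subblock: i + j + n is twice the centre of the reflection, plus one.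
  Mir-sub : Mir i j n → i ≤ i′ → j ≤ j′ → i′ + j′ + n′ ≡ i + j + n → Mir i′ j′ n′
  Mir-sub {i} {j} {n} {n′ = n′} h i≤i′ j≤j′ e m m′ e′ with m≤n⇒∃[o]m+o≡n i≤i′ | m≤n⇒∃[o]m+o≡n j≤j′
  ... | x , refl | y , refl = trans (cong u (+-assoc i x m)) (trans (h (x + m) (y + m′) e″) (cong u (sym (+-assoc j y m′))))
    where
    e″ : suc (x + m + (y + m′)) ≡ n
    e″ = +-cancelˡ-≡ (i + j) _ _ (trans (eq i j x y m m′) (trans (cong (i + x + (j + y) +_) e′) e))
      where
      eq : ∀ i j x y m m′ → i + j + suc (x + m + (y + m′)) ≡ i + x + (j + y) + suc (m + m′)
      eq = solve-∀

  Mir-tail-init : Mir i j (suc n) → Mir (suc i) j n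
  Mir-tail-init {i} {j} {n} h = Mir-sub h (n≤1+n i) ≤-refl (sym (+-suc (i + j) n))

  Mir-init-tail : Mir i j (suc n) → Mir i (suc j) n
  Mir-init-tail h = Mir-sym (Mir-tail-init (Mir-sym h))

  Eqv-snoc : Eqv i j n → u (i + n) ≡ u (j + n) → Eqv i j (suc n)
  Eqv-snoc {n = n} h e m (s≤s m≤n) with m≤n⇒m<n∨m≡n m≤n
  ... | inj₁ m<n  = h m m<n
  ... | inj₂ refl = e

  Eqv-cons : u i ≡ u j → Eqv (suc i) (suc j) n → Eqv i j (suc n)
  Eqv-cons {i} {j} e h zero m<n = trans (cong u (+-identityʳ i)) (trans e (cong u (sym (+-identityʳ j))))
  Eqv-cons {i} {j} e h (suc m) (s≤s m<n) = trans (cong u (+-suc i m)) (trans (h m m<n) (cong u (sym (+-suc j m))))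

  Mir-cons : u i ≡ u (j + n) → Mir (suc i) j n → Mir i j (suc n)
  Mir-cons {i} {j} e h zero m′ refl = trans (cong u (+-identityʳ i)) e
  Mir-cons {i} {j} e h (suc m) m′ refl = trans (cong u (+-suc i m)) (h m m′ refl)

  Eqv? : ∀ i j n → Dec (Eqv i j n)
  Eqv? i j n = map′ (λ h m m<n → h m<n) (λ h {m} m<n → h m m<n) (allUpTo? (λ m → u (i + m) Fin.≟ u (j + m)) n)

  Mir? : ∀ i j n → Dec (Mir i j n)
  Mir? i j zero    = yes λ _ _ ()
  Mir? i j (suc n) = map′
    (λ (h , h′) → Mir-cons h h′)
    (λ h → trans (cong u (sym (+-identityʳ i))) (h 0 n refl) , Mir-tail-init h)
    ((u i Fin.≟ u (j + n)) ×-dec Mir? (suc i) j n)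

  abstract
    Cong? : ∀ i j n → Dec (Cong i j n)
    Cong? i j n = Eqv? i j n ⊎-dec Mir? i j n

  Cong-ends : Cong i j (suc n) →
    (Cong i j n × Cong (suc i) (suc j) n) ⊎ (Cong i (suc j) n × Cong (suc i) j n)
  Cong-ends (inj₁ h) = inj₁ (inj₁ (Eqv-init (n≤1+n _) h) , inj₁ (Eqv-tail h))
  Cong-ends (inj₂ h) = inj₂ (inj₂ (Mir-init-tail h) , inj₂ (Mir-tail-init h))

  -- Equal ends force a constant block, and mirrored ends express the symmetry of the whole block.
  -- Hence the loops of the quotient graph are exactly the palindromic edges.
  Cong-suc⇒Mir : Cong i (suc i) n → Mir i i (suc n)
  Cong-suc⇒Mir {i} {n} (inj₁ h) m m′ refl = trans (const m (m≤m+n m m′)) (sym (const m′ (m≤n+m m′ m)))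
    where
    const : ∀ m → m ≤ n → u (i + m) ≡ u i
    const zero    _   = cong u (+-identityʳ i)
    const (suc m) m<n = trans (cong u (+-suc i m)) (trans (sym (h m m<n)) (const m (<⇒≤ m<n)))
  Cong-suc⇒Mir {i} (inj₂ h) zero zero refl = refl
  Cong-suc⇒Mir {i} (inj₂ h) m (suc m′) refl = trans (h m m′ (sym (+-suc m m′))) (cong u (sym (+-suc i m′)))
  Cong-suc⇒Mir {i} (inj₂ h) (suc m) zero refl =
    sym (trans (h 0 m (cong suc (sym (+-identityʳ m)))) (cong u (sym (+-suc i m))))

  -- Rauzy graphs modulo reversal, and palindromic returns.

  occ : ℕ → ℕ → ℕ → Bool
  occ n p k = does (Cong? k p n)

  occ-cong : Cong i j n → ∀ p → occ n p i ≡ occ n p j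
  occ-cong {i} {j} {n} c p = does-cong (Cong? i p n) (Cong? j p n) (Cong-trans (Cong-sym c)) (Cong-trans c)

  -- In the Rauzy graph of order n, with every word identified with its mirror
  -- image, the walk along u crosses the edge of p an even number of times
  -- between two visits of a vertex: the edges that are not loops are bridges.
  Tree : ℕ → Set
  Tree n = ∀ p → ¬ Mir p p (suc n) → ∀ i j → Cong i j n →
           parity (occ (suc n) p) i ≡ parity (occ (suc n) p) j

  -- Complete returns to the set formed by a block and its mirror image. `L` is their length
  -- `j + n - i`, given by an equation to avoid truncated subtraction.
  PalReturns : ℕ → Set
  PalReturns n = ∀ i j → i < j → Cong i j n → (∀ k → i < k → k < j → ¬ Cong k j n) →
                 ∀ L → i + L ≡ j + n → Mir i i L

  -- In a palindromic return, mirrored positions carry the same edge and cancel; a central edge is a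
  -- palindrome, hence a loop and never `p`. Any other closed walk is cut at its intermediate visits
  -- into such returns.
  PalReturns⇒Tree : PalReturns n → Tree n
  PalReturns⇒Tree {n} ret p ¬pal = λ i j c → wlog i j c
    where
    f = occ (suc n) p

    go : ∀ d i j → j ≤ i + d → i < j → Cong i j n → parity f i ≡ parity f j
    go zero i j j≤i i<j c = contradiction (≤-trans i<j (≤-trans j≤i (≤-reflexive (+-identityʳ i)))) (<-irrefl refl)
    go (suc d) i j j≤ i<j c with anyUpTo? (λ k → (i <? k) ×-dec Cong? k j n) j
    ... | yes (k , k<j , i<k , c′) =
      trans (go d i k (s≤s⁻¹ (≤-trans k<j (≤-trans j≤ (≤-reflexive (+-suc i d))))) i<k (Cong-trans c (Cong-sym c′)))
            (go d k j (≤-trans j≤ (≤-trans (≤-reflexive (+-suc i d)) (+-monoˡ-≤ d i<k))) k<j c′)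
    ... | no none with m≤n⇒∃[o]m+o≡n (<⇒≤ i<j)
    ...   | e , refl = parity-symmetric f i e
              (λ k l i≤k i≤l eq → occ-cong (inj₂ (Mir-sub pal i≤k i≤l (shift k l eq))) p)
              (λ k i≤k eq → dec-false (Cong? k p (suc n))
                (λ c″ → ¬pal (self c″ (Mir-sub pal i≤k i≤k (shift k k eq)))))
      where
      pal = ret i (i + e) i<j c (λ k i<k k<j c′ → none (k , k<j , i<k , c′)) (e + n) (sym (+-assoc i e n))
      eq₁ : ∀ k l n → k + l + suc n ≡ suc (k + l) + n
      eq₁ = solve-∀
      eq₂ : ∀ i e n → i + (i + e) + n ≡ i + i + (e + n)
      eq₂ = solve-∀
      shift : ∀ k l → suc (k + l) ≡ i + (i + e) → k + l + suc n ≡ i + i + (e + n)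
      shift k l eq = trans (eq₁ k l n) (trans (cong (_+ n) eq) (eq₂ i e n))
      self : Cong k p (suc n) → Mir k k (suc n) → Mir p p (suc n)
      self (inj₁ h) m = Eqv-Mir (Eqv-sym h) (Mir-Eqv m h)
      self (inj₂ h) m = Mir-Eqv (Mir-sym h) (Mir-Mir m h)

    wlog : ∀ i j → Cong i j n → parity f i ≡ parity f j
    wlog i j c with <-cmp i j
    ... | tri< i<j _ _ = go j i j (m≤n+m j i) i<j c
    ... | tri≈ _ refl _ = refl
    ... | tri> _ _ j<i = sym (go i j i (m≤n+m i j) j<i (Cong-sym c))

  -- The walk comes back over the edge by which it left. From that edge to itself there is a
  -- complete return at order n + 1, one step shorter and covering the same letters; the order grows
  -- along the induction, so trees are needed at every order.
  Tree⇒PalReturns : (∀ n → Tree n) → ∀ n → PalReturns n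
  Tree⇒PalReturns tree n i j i<j with m≤n⇒∃[o]m+o≡n i<j
  ... | d , refl = go d n i
    where
    go : ∀ d n i → let j = suc i + d in Cong i j n → (∀ k → i < k → k < j → ¬ Cong k j n) →
         ∀ L → i + L ≡ j + n → Mir i i L
    go zero n i c none L eL =
      subst (Mir i i) (+-cancelˡ-≡ i _ _ (trans (+-suc i n) (trans (cong (λ x → suc (x + n)) (sym (+-identityʳ i))) (sym eL))))
        (Cong-suc⇒Mir (subst (λ x → Cong i (suc x) n) (+-identityʳ i) c))
    go (suc d) n i c none L eL with anyUpTo? (λ k → (i <? k) ×-dec Cong? k i (suc n)) (suc i + suc d)
    ... | yes (k , k<j , i<k , ck) = found (Cong-ends ck)
      where
      J = suc i + d
      J≡ : suc i + suc d ≡ suc J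
      J≡ = +-suc (suc i) d
      noCong : ∀ k → i < k → k < suc i + suc d → ¬ Cong k i n
      noCong k i<k k<j c′ = none k i<k k<j (Cong-trans c′ c)
      found : _ → Mir i i L
      -- Met forwards, the edge starts at a premature visit of the vertex; met backwards, it ends at
      -- a visit, which can only be the last one.
      found (inj₁ (c₁ , _)) = contradiction c₁ (noCong k i<k k<j)
      found (inj₂ (_ , c₂)) with m≤n⇒m<n∨m≡n k<j
      ... | inj₁ k+1<j = contradiction c₂ (noCong (suc k) (m≤n⇒m≤1+n i<k) k+1<j)
      ... | inj₂ k+1≡j = go d (suc n) i (subst (λ x → Cong i x (suc n)) k≡J (Cong-sym ck)) none′ L
                            (trans eL (trans (cong (_+ n) J≡) (sym (+-suc J n))))
        where
        k≡J : k ≡ J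
        k≡J = suc-injective (trans k+1≡j J≡)
        none′ : ∀ k′ → i < k′ → k′ < J → ¬ Cong k′ J (suc n)
        none′ k′ i<k′ k′<J c′ with Cong-ends (Cong-trans c′ (subst (λ x → Cong x i (suc n)) k≡J ck))
        ... | inj₁ (c₁ , _) = noCong k′ i<k′ (<-trans k′<J (subst (J <_) (sym J≡) (n<1+n J))) c₁
        ... | inj₂ (_ , c₂) = noCong (suc k′) (m≤n⇒m≤1+n i<k′) (subst (suc k′ <_) (sym J≡) (s≤s k′<J)) c₂
    -- The first edge is crossed exactly once on this closed walk, an odd number.
    ... | no noEdge = contradiction even odd
      where
      ¬pal : ¬ Mir i i (suc n)
      ¬pal h = none (suc i) (n<1+n i) (subst (suc (suc i) ≤_) (sym (+-suc (suc i) d)) (s≤s (s≤s (m≤m+n i d))))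
                 (Cong-trans (inj₂ (Mir-tail-init h)) c)
      f = occ (suc n) i
      even : parity f i ≡ parity f (suc i)
      even = trans (tree n i ¬pal i (suc i + suc d) c) (sym (parity-false f (suc i) (suc d)
        (λ k i<k k<j → dec-false (Cong? k i (suc n)) (λ c′ → noEdge (k , k<j , i<k , c′)))))
      flip : ∀ b → ¬ b ≡ b xor true
      flip false ()
      flip true ()
      odd : ¬ parity f i ≡ parity f (suc i)
      odd e = flip (parity f i) (trans e (cong (parity f i xor_) (dec-true (Cong? i i (suc n)) Cong-refl)))

  -- First occurrences of palindromic suffixes.

  NewAt : ℕ → ℕ → Set
  NewAt s l = Mir s s l × (∀ i → i < s → ¬ Eqv i s l)

  -- For positive `N`: the last letter of the prefix of length `N` brings a new palindrome. The
  -- lengths where this fails are the ones counted by `lacunas`.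
  NewPalSuffix : ℕ → Set
  NewPalSuffix N = ∃₂ λ s l → s + l ≡ N × NewAt s l

  Recurrent : Set
  Recurrent = ∀ i n t → ∃ λ j → t ≤ j × Eqv i j n

  MirrorClosed : Set
  MirrorClosed = ∀ i n → ∃ λ j → Mir i j n

  -- Let `s` start the new palindromic suffix of the prefix that the return ends. For `s ≥ j`, the
  -- copy of the last block at `i` repeats the suffix too early. For `i < s < j`, reflection creates
  -- a visit at `s`. For `s = i` the return is the suffix itself. For `s < i`, reflection carries
  -- the return to one that ends earlier, and induction applies.
  NewPalSuffix⇒PalReturns : ∀ N → (∀ M → N ≤ M → NewPalSuffix M) → ∀ n → N ≤ n → PalReturns n
  NewPalSuffix⇒PalReturns N newPal n N≤n i j = go (suc j) i j (n<1+n j)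
    where
    go : ∀ b i j → j < b → i < j → Cong i j n → (∀ k → i < k → k < j → ¬ Cong k j n) →
         ∀ L → i + L ≡ j + n → Mir i i L
    go (suc b) i j (s≤s j≤b) i<j c none L eL with newPal (j + n) (≤-trans N≤n (m≤n+m n j))
    ... | s , l , e , pal , new with <-cmp s j
    ...   | tri≈ _ refl _ = ⊥-elim (new i i<j (eqv c))
      where
      l≡n = +-cancelˡ-≡ j l n e
      eqv : Cong i j n → Eqv i j l
      eqv (inj₁ h) = subst (Eqv i j) (sym l≡n) h
      eqv (inj₂ h) = Mir-Mir (subst (Mir i j) (sym l≡n) h) pal
    ...   | tri> _ _ j<s with m≤n⇒∃[o]m+o≡n (<⇒≤ j<s) | c
    ...     | o , refl | inj₁ h = ⊥-elim (new (i + o) (+-monoˡ-< o i<j)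
                (Eqv-drop o (≤-reflexive (+-cancelˡ-≡ j _ _ (trans (sym (+-assoc j o l)) e))) h))
    ...     | o , refl | inj₂ h = ⊥-elim (new i (<-trans i<j j<s)
                (Mir-Mir (Mir-sub h ≤-refl (m≤m+n j o)
                  (trans (+-assoc i (j + o) l) (trans (cong (i +_) e) (sym (+-assoc i j n))))) pal))
    go (suc b) i j (s≤s j≤b) i<j c none L eL | s , l , e , pal , new | tri< s<j _ _
      with <-cmp i s
    ... | tri< i<s _ _ = contradiction
          (inj₂ (Mir-sub pal ≤-refl (<⇒≤ s<j)
            (trans (+-assoc s j n) (trans (cong (s +_) (sym e)) (sym (+-assoc s s l))))))
          (none s i<s s<j)
    ... | tri≈ _ refl _ = subst (Mir i i) (+-cancelˡ-≡ i l L (trans e (sym eL))) pal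
    ... | tri> _ _ s<i with m≤n⇒∃[o]m+o≡n s<i | m≤n⇒∃[o]m+o≡n i<j
    ...   | o₁ , refl | o₂ , refl = Eqv-Mir (Mir-Mir is ss) (Mir-sym is)
      where
      -- `suc o₂` is `j - i`, so the reflected return runs from `s` to `r`, with the images of the
      -- blocks at `j` and `i` as its ends.
      r = s + suc o₂
      r<j : r < suc (suc s + o₁) + o₂
      r<j = subst₂′ (s≤s (+-monoˡ-≤ (suc o₂) (m≤m+n s o₁)))
        where
        eq : ∀ s o₁ o₂ → s + o₁ + suc o₂ ≡ suc s + o₁ + o₂
        eq = solve-∀
        subst₂′ : suc r ≤ suc (s + o₁ + suc o₂) → r < suc (suc s + o₁) + o₂
        subst₂′ p = subst (λ x → suc r ≤ suc x) (eq s o₁ o₂) p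
      twice : s + (suc (suc s + o₁) + o₂ + n) ≡ s + s + l
      twice = trans (cong (s +_) (sym e)) (sym (+-assoc s s l))
      i≥s : s ≤ suc s + o₁
      i≥s = ≤-trans (n≤1+n s) (m≤m+n (suc s) o₁)
      ir : Mir (suc s + o₁) r n
      ir = Mir-sub pal i≥s (m≤m+n s (suc o₂)) (trans (eq s o₁ o₂ n) twice)
        where
        eq : ∀ s o₁ o₂ n → suc s + o₁ + (s + suc o₂) + n ≡ s + (suc (suc s + o₁) + o₂ + n)
        eq = solve-∀
      sj : Mir s (suc (suc s + o₁) + o₂) n
      sj = Mir-sub pal ≤-refl (<⇒≤ s<j) (trans (+-assoc s _ n) twice)
      is : Mir (suc s + o₁) s L
      is = Mir-sub pal i≥s ≤-refl (trans (eq s o₁ L) (trans (cong (s +_) eL) twice))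
        where
        eq : ∀ s o₁ L → suc s + o₁ + s + L ≡ s + (suc s + o₁ + L)
        eq = solve-∀
      none′ : ∀ k → s < k → k < r → ¬ Cong k r n
      none′ k s<k k<r ck with m≤n⇒∃[o]m+o≡n s<k
      ... | p , refl with m≤n⇒∃[o]m+o≡n k<r
      ...   | q , eq = none (suc s + o₁ + suc q) (m<m+n _ (s≤s z≤n)) k″<j
                (Cong-trans (inj₂ (Mir-sym kk″)) (Cong-trans ck (Cong-trans (inj₂ (Mir-sym ir)) c)))
        where
        o₂≡ : suc (p + q) ≡ o₂
        o₂≡ = suc-injective (+-cancelˡ-≡ s _ _ (trans (eq′ s p q) eq))
          where
          eq′ : ∀ s p q → s + suc (suc (p + q)) ≡ suc (suc s + p) + q
          eq′ = solve-∀
        k″<j : suc s + o₁ + suc q < suc (suc s + o₁) + o₂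
        k″<j = s≤s (+-monoʳ-≤ (suc s + o₁) (subst (suc q ≤_) o₂≡ (s≤s (m≤n+m q p))))
        kk″ : Mir (suc s + p) (suc s + o₁ + suc q) n
        kk″ = Mir-sub pal (≤-trans (n≤1+n s) (m≤m+n (suc s) p)) (≤-trans i≥s (m≤m+n _ (suc q)))
          (trans (eq′ s o₁ p q n) (trans (cong (λ x → s + (suc (suc s + o₁) + x + n)) o₂≡) twice))
          where
          eq′ : ∀ s o₁ p q n → suc s + p + (suc s + o₁ + suc q) + n ≡ s + (suc (suc s + o₁) + suc (p + q) + n)
          eq′ = solve-∀
      ss : Mir s s L
      ss = go b s r (≤-trans r<j j≤b) (m<m+n s (s≤s z≤n))
             (Cong-trans (inj₂ sj) (Cong-trans (Cong-sym c) (inj₂ ir))) none′ L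
             (+-cancelˡ-≡ (suc o₁) _ _ (trans (eq₁ s o₁ L) (trans eL (eq₂ s o₁ o₂ n))))
        where
        eq₁ : ∀ s o₁ L → suc o₁ + (s + L) ≡ suc s + o₁ + L
        eq₁ = solve-∀
        eq₂ : ∀ s o₁ o₂ n → suc (suc s + o₁) + o₂ + n ≡ suc o₁ + (s + suc o₂ + n)
        eq₂ = solve-∀

  -- A late occurrence of the block is reflected in the new palindromic suffix of the prefix it
  -- ends. A suffix lying inside the block would already have occurred in the copy at `i`.
  NewPalSuffix⇒MirrorClosed : ∀ N → (∀ M → N ≤ M → NewPalSuffix M) → Recurrent → MirrorClosed
  NewPalSuffix⇒MirrorClosed N newPal rec i n with rec i n (suc i + N)
  ... | j , i+N<j , h with newPal (j + n) (≤-trans (≤-trans (m≤n+m N (suc i)) i+N<j) (m≤m+n j n))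
  ...   | s , l , e , pal , new with s <? j
  ...     | yes s<j = s , Eqv-Mir h (Mir-sub pal (<⇒≤ s<j) ≤-refl
                (trans (eq j s n) (trans (cong (s +_) (sym e)) (sym (+-assoc s s l)))))
    where
    eq : ∀ j s n → j + s + n ≡ s + (j + n)
    eq = solve-∀
  ...     | no s≮j with m≤n⇒∃[o]m+o≡n (≮⇒≥ s≮j)
  ...       | o , refl = ⊥-elim (new (i + o) (+-monoˡ-< o (≤-trans (m≤m+n (suc i) N) i+N<j))
                (Eqv-drop o (≤-reflexive (+-cancelˡ-≡ j _ _ (trans (sym (+-assoc j o l)) e))) h))

  -- Passages of the walk through a vertex.

  -- For a non-palindromic block t, the four extensions form a cycle in the graph
  -- of order n + 1.
  Strong : ℕ → ℕ → Set
  Strong t n = ∀ a b → ∃ λ q → Eqv (suc q) t n × u q ≡ a × u (suc q + n) ≡ b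

  occ-true : Cong k p n → occ n p k ≡ true
  occ-true {k} {p} {n} = dec-true (Cong? k p n)

  occ-false : ¬ Cong k p n → occ n p k ≡ false
  occ-false {k} {p} {n} = dec-false (Cong? k p n)

  occ⁻¹ : occ n p k ≡ true → Cong k p n
  occ⁻¹ {n} {p} {k} = does⁻¹ (Cong? k p n)

  occ⁻¹-false : occ n p k ≡ false → ¬ Cong k p n
  occ⁻¹-false {n} {p} {k} = does⁻¹-false (Cong? k p n)

  -- The parity of the number of passages through the vertex t on which exactly
  -- one of the two edges taken is r depends only on the edge class reached: if
  -- r is a bridge, this parity tells the side of r on which the walk is.
  passage : ℕ → ℕ → ℕ → ℕ → Bool
  passage n r t k = occ n t (suc k) ∧ (occ (suc n) r k xor occ (suc n) r (suc k))

  Cong-edge : ∀ {r} → Cong k r (suc n) → Cong r t n ⊎ Cong (suc r) t n → Cong k t n ⊎ Cong (suc k) t n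
  Cong-edge c (inj₁ i) with Cong-ends c
  ... | inj₁ (x , _) = inj₁ (Cong-trans x i)
  ... | inj₂ (_ , y) = inj₂ (Cong-trans y i)
  Cong-edge c (inj₂ i) with Cong-ends c
  ... | inj₁ (_ , y) = inj₂ (Cong-trans y i)
  ... | inj₂ (x , _) = inj₁ (Cong-trans x i)

  passage-parity : Tree n → ∀ r t → Cong r t n ⊎ Cong (suc r) t n →
    ∀ i j → Cong i j (suc n) → parity (passage n r t) i ≡ parity (passage n r t) j
  passage-parity {n} tree r t inc i j c with Mir? r r (suc n)
  -- A loop can only be entered and left through `t`, so the passages are exactly the changes of
  -- `occ (suc n) r`.
  ... | yes pal = trans (tel i) (trans (cong (occ (suc n) r 0 xor_) (occ-cong c r)) (sym (tel j)))
    where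
    loop : Cong r (suc r) n
    loop = inj₂ (Mir-init-tail pal)
    rt : Cong r t n × Cong (suc r) t n
    rt = [ (λ x → x , Cong-trans (Cong-sym loop) x) , (λ x → Cong-trans loop x , x) ]′ inc
    both : ∀ {k} → Cong k r (suc n) → Cong k t n × Cong (suc k) t n
    both c′ with Cong-ends c′
    ... | inj₁ (x , y) = Cong-trans x (proj₁ rt) , Cong-trans y (proj₂ rt)
    ... | inj₂ (x , y) = Cong-trans x (proj₂ rt) , Cong-trans y (proj₁ rt)
    tel = parity-telescope (passage n r t) (occ (suc n) r) eq
      where
      eq : ∀ k → passage n r t k ≡ occ (suc n) r k xor occ (suc n) r (suc k)
      eq k with Cong? (suc k) t n
      ... | yes w = refl
      ... | no ¬w = sym (cong₂ _xor_ (occ-false {k} {r} (λ x → ¬w (proj₂ (both x)))) (occ-false {suc k} {r} (λ x → ¬w (proj₁ (both x)))))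
  ... | no ¬pal = trans (tel i) (trans (cong (side 0 xor_) side-cong) (sym (tel j)))
    where
    I = occ (suc n) r
    -- `false` on the side of `t`, `true` on `r` and beyond it; a passage is then a change of
    -- `side`. The premises of `table` give the parity at whichever of the three vertices around is
    -- `t`.
    side : ℕ → Bool
    side k = if I k then true else parity I k xor parity I t
    table : ∀ w a b x y → (w ≡ true → x xor a ≡ y) → (w ≡ false → a ≡ true → x ≡ y) →
      (w ≡ false → b ≡ true → (x xor a) xor b ≡ y) →
      w ∧ (a xor b) ≡ (if a then true else x xor y) xor (if b then true else (x xor a) xor y)
    table true false false false y h _ _ rewrite sym (h refl) = refl
    table true false false true y h _ _ rewrite sym (h refl) = refl
    table true false true false y h _ _ rewrite sym (h refl) = refl
    table true false true true y h _ _ rewrite sym (h refl) = refl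
    table true true false false y h _ _ rewrite sym (h refl) = refl
    table true true false true y h _ _ rewrite sym (h refl) = refl
    table true true true x y h _ _ = refl
    table false true true x y _ h _ = refl
    table false true false false y _ h _ rewrite sym (h refl refl) = refl
    table false true false true y _ h _ rewrite sym (h refl refl) = refl
    table false false true false y _ _ h rewrite sym (h refl refl) = refl
    table false false true true y _ _ h rewrite sym (h refl refl) = refl
    table false false false false y _ _ _ = sym (xor-same y)
    table false false false true y _ _ _ = sym (xor-same (true xor y))
    tel = parity-telescope (passage n r t) side (λ k →
      table (occ n t (suc k)) (I k) (I (suc k)) (parity I k) (parity I t)
        (λ w → tree r ¬pal (suc k) t (occ⁻¹ {n} {t} {suc k} w))
        (λ ¬w e → tree r ¬pal k t
          ([ (λ x → x) , (λ x → contradiction x (occ⁻¹-false {n} {t} {suc k} ¬w)) ]′ (Cong-edge (occ⁻¹ {suc n} {r} {k} e) inc)))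
        (λ ¬w e → tree r ¬pal (suc (suc k)) t
          ([ (λ x → contradiction x (occ⁻¹-false {n} {t} {suc k} ¬w)) , (λ x → x) ]′ (Cong-edge (occ⁻¹ {suc n} {r} {suc k} e) inc))))
    side-cong : side i ≡ side j
    side-cong = lemma (I i) (I j) refl (occ-cong c r)
      where
      lemma : ∀ a b → I j ≡ b → a ≡ b →
        (if a then true else parity I i xor parity I t) ≡ (if b then true else parity I j xor parity I t)
      lemma true  _ _ refl = refl
      lemma false _ e refl with Cong-ends c
      ... | inj₁ (x , _) = cong (_xor parity I t) (tree r ¬pal i j x)
      ... | inj₂ (x , _) = cong (_xor parity I t) (trans (tree r ¬pal i (suc j) x)
              (trans (cong (parity I j xor_) e) (xor-identityʳ (parity I j))))

  snoc-Cong : Eqv i j n → u (i + n) ≡ u (j + n) → Cong i j (suc n)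
  snoc-Cong h e = inj₁ (Eqv-snoc h e)

  -- In the mirrored case the last letter of each block is the first letter of the other, and the
  -- first letters agree. Length 0 offers no common first letter and is treated apart.
  Cong-snoc : Eqv i j n → Cong i j (suc n) → u (i + n) ≡ u (j + n)
  Cong-snoc {n = n} h (inj₁ g) = g n (n<1+n n)
  Cong-snoc {n = zero} h (inj₂ g) = g 0 0 refl
  Cong-snoc {i} {j} {n = suc n} h (inj₂ g) =
    trans (g (suc n) 0 (cong (λ x → suc (suc x)) (+-identityʳ n)))
      (trans (sym (h 0 (s≤s z≤n))) (g 0 (suc n) refl))

  cons-Cong : Eqv (suc i) (suc j) n → u i ≡ u j → Cong i j (suc n)
  cons-Cong h e = inj₁ (Eqv-cons e h)

  Cong-cons : Eqv (suc i) (suc j) n → Cong i j (suc n) → u i ≡ u j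
  Cong-cons {i} {j} h (inj₁ g) = at0 (g 0 (s≤s z≤n))
    where
    at0 : u (i + 0) ≡ u (j + 0) → u i ≡ u j
    at0 e = trans (cong u (sym (+-identityʳ i))) (trans e (cong u (+-identityʳ j)))
  Cong-cons {i} {j} {zero} h (inj₂ g) =
    trans (cong u (sym (+-identityʳ i))) (trans (g 0 0 refl) (cong u (+-identityʳ j)))
  Cong-cons {i} {j} {suc n} h (inj₂ g) = begin
    u i               ≡⟨ cong u (sym (+-identityʳ i)) ⟩
    u (i + 0)         ≡⟨ g 0 (suc n) refl ⟩
    u (j + suc n)     ≡⟨ cong u (+-suc j n) ⟩
    u (suc j + n)     ≡⟨ sym (h n (n<1+n n)) ⟩
    u (suc i + n)     ≡⟨ cong u (sym (+-suc i n)) ⟩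
    u (i + suc n)     ≡⟨ g (suc n) 0 (cong (λ x → suc (suc x)) (+-identityʳ n)) ⟩
    u (j + 0)         ≡⟨ cong u (+-identityʳ j) ⟩
    u j               ∎
    where open ≡-Reasoning

  Eqv-suc⇒Mir : Eqv i (suc i) n → Mir (suc i) (suc i) n
  Eqv-suc⇒Mir h = Eqv-Mir (Eqv-sym h) (Mir-init-tail (Cong-suc⇒Mir (inj₁ h)))

  -- An equality `wb = aw` makes `w` a power of one letter, and a mirrored pair makes it symmetric
  -- at once. So the left and right edges at a non-palindromic `w` are never of the same class.
  Cong-shift⇒Mir : Eqv (suc k) (suc p) n → Cong (suc k) p (suc n) → Mir (suc p) (suc p) n
  Cong-shift⇒Mir h (inj₁ g) = Eqv-suc⇒Mir (Eqv-trans (Eqv-sym (Eqv-init (n≤1+n _) g)) h)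
  Cong-shift⇒Mir h (inj₂ g) = Eqv-Mir (Eqv-sym h) (Mir-init-tail g)

  -- At a palindrome `w`, by contrast, `aw` and `wa` are one edge: both sides share the same
  -- classes, told apart by the letter.
  Mir-shift : Eqv (suc k) (suc p) n → Mir (suc p) (suc p) n → u (suc k + n) ≡ u p → Cong (suc k) p (suc n)
  Mir-shift h m e = inj₂ (Mir-sym (Mir-cons (sym e) (Mir-Eqv m (Eqv-sym h))))

  Cong-shift-letter : Eqv (suc k) (suc p) n → Mir (suc p) (suc p) n → Cong (suc k) p (suc n) → u (suc k + n) ≡ u p
  Cong-shift-letter {k} {p} {n} h m (inj₂ g) = trans (g n 0 (cong suc (+-identityʳ n))) (cong u (+-identityʳ p))
  Cong-shift-letter {k} {p} {zero} h m (inj₁ g) = trans (g 0 (s≤s z≤n)) (cong u (+-identityʳ p))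
  Cong-shift-letter {k} {p} {suc n} h m (inj₁ g) = begin
    u (suc k + suc n) ≡⟨ g (suc n) (n<1+n _) ⟩
    u (p + suc n)     ≡⟨ cong u (+-suc p n) ⟩
    u (suc p + n)     ≡⟨ m n 0 (cong suc (+-identityʳ n)) ⟩
    u (suc p + 0)     ≡⟨ sym (h 0 (s≤s z≤n)) ⟩
    u (suc k + 0)     ≡⟨ g 0 (s≤s z≤n) ⟩
    u (p + 0)         ≡⟨ cong u (+-identityʳ p) ⟩
    u p               ∎
    where open ≡-Reasoning

  Cong-middle : Cong k p (suc (suc n)) → Cong (suc k) (suc p) n
  Cong-middle (inj₁ h) = inj₁ (Eqv-init (n≤1+n _) (Eqv-tail h))
  Cong-middle (inj₂ h) = inj₂ (Mir-tail-init (Mir-init-tail h))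

  passage-miss : ∀ r {k t n} → ¬ Cong (suc k) t n → passage n r t k ≡ false
  passage-miss r {k} {t} {n} ¬c = cong (_∧ (occ (suc n) r k xor occ (suc n) r (suc k))) (occ-false {suc k} {t} {n} ¬c)

  passage-hit : ∀ r {k t n} → Cong (suc k) t n → passage n r t k ≡ occ (suc n) r k xor occ (suc n) r (suc k)
  passage-hit r {k} {t} {n} c = cong (_∧ (occ (suc n) r k xor occ (suc n) r (suc k))) (occ-true {suc k} {t} {n} c)

  passage-mirror : ∀ r {t} → Mir k j (suc (suc n)) → passage n r t k ≡ passage n r t j
  passage-mirror {k} {j} {n} r {t} m = cong₂ _∧_
    (occ-cong (Cong-middle (inj₂ m)) t)
    (trans (cong₂ _xor_ (occ-cong (inj₂ (Mir-init-tail m)) r) (occ-cong (inj₂ (Mir-tail-init m)) r))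
      (xor-comm (occ (suc n) r (suc j)) (occ (suc n) r j)))

-- Two letters: from trees of order n to trees of order n + 1.

binary : (a b c : Fin 2) → a ≢ b → b ≢ c → a ≡ c
binary zero zero c a≢b _ = contradiction refl a≢b
binary zero (suc zero) zero _ _ = refl
binary zero (suc zero) (suc zero) _ b≢c = contradiction refl b≢c
binary (suc zero) zero zero _ b≢c = contradiction refl b≢c
binary (suc zero) zero (suc zero) _ _ = refl
binary (suc zero) (suc zero) c a≢b _ = contradiction refl a≢b

module BinaryBlocks (u : InfWord 2) where
  open Blocks u

  private
    variable
      k n : ℕ

  -- An edge of the new graph is `cwd` with `w` of length n, a vertex of the old tree, so its
  -- crossings can be expressed by passages through `w`. For a non-palindromic `w` the expression
  -- depends on which of the four extensions `awb` occur.
  Tree-suc : MirrorClosed → (∀ t → ¬ Mir t t n → ¬ Strong t n) → Tree n → Tree (suc n)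
  Tree-suc {n} closed noStrong tree p ¬pal i j cij with Mir? (suc p) (suc p) n
  ... | yes palw = trans (parity-cong F i) (trans (passage-parity tree p (suc p) (inj₂ Cong-refl) i j cij) (sym (parity-cong F j)))
    where
    c≢d : u p ≢ u (suc p + n)
    c≢d e = ¬pal (Mir-cons (trans e (cong u (sym (+-suc p n)))) (Mir-sym (Mir-cons e palw)))
    -- As `aw` and `wa` are the same edge, `cwd` with `c ≢ d`, or its mirror image, is crossed iff
    -- exactly one of the two edges taken at `w` is `cw`.
    F : ∀ k → occ (suc (suc n)) p k ≡ passage n p (suc p) k
    F k = by (Cong? (suc k) (suc p) n)
      where
      by : Dec (Cong (suc k) (suc p) n) → occ (suc (suc n)) p k ≡ passage n p (suc p) k
      by (no ¬w) = trans (occ-false {k} {p} (λ x → ¬w (Cong-middle x))) (sym (passage-miss p ¬w))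
      by (yes w) = trans (does-xor (Cong? k p (suc (suc n))) (Cong? k p (suc n)) (Cong? (suc k) p (suc n)) split left right)
                         (sym (passage-hit p w))
        where
        eqv : Eqv (suc k) (suc p) n
        eqv = [ (λ x → x) , (λ x → Mir-Mir x palw) ]′ w
        split : Cong k p (suc (suc n)) → Cong k p (suc n) × ¬ Cong (suc k) p (suc n) ⊎ ¬ Cong k p (suc n) × Cong (suc k) p (suc n)
        split (inj₁ h) = inj₁ (inj₁ (Eqv-init (n≤1+n _) h) , λ x →
          c≢d (trans (sym (Cong-shift-letter eqv palw x)) (Cong-snoc eqv (inj₁ (Eqv-tail h)))))
        split (inj₂ h) = inj₂ ((λ x → c≢d (trans (sym (Cong-cons eqv x))
            (trans (cong u (sym (+-identityʳ k))) (trans (h 0 (suc n) refl) (cong u (+-suc p n)))))) , inj₂ (Mir-tail-init h))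
        left : Cong k p (suc n) → ¬ Cong (suc k) p (suc n) → Cong k p (suc (suc n))
        left x y = inj₁ (Eqv-cons (Cong-cons eqv x) (Eqv-snoc eqv
          (binary (u (suc k + n)) (u p) (u (suc p + n)) (λ e → y (Mir-shift eqv palw e)) c≢d)))
        right : ¬ Cong k p (suc n) → Cong (suc k) p (suc n) → Cong k p (suc (suc n))
        right x y = inj₂ (Mir-cons (trans (binary (u k) (u p) (u (suc p + n)) (λ e → x (cons-Cong eqv e)) c≢d) (cong u (sym (+-suc p n))))
          (Mir-sym (Mir-cons (sym (Cong-shift-letter eqv palw y)) (Mir-Eqv palw (Eqv-sym eqv)))))
  -- Whether an extension of `w` occurs somewhere is not decidable here, so the case analysis is
  -- made under double negation.
  ... | no ¬palw = decidable-stable (_ ≟ᵇ _) goal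
    where
    t = suc p
    d = u (t + n)
    N = suc (suc n)

    CutsAt : ℕ → Set
    CutsAt q = parity (occ N q) i ≡ parity (occ N q) j

    Realised : (Fin 2 → Set) → (Fin 2 → Set) → Set
    Realised P Q = ∃ λ q → Eqv (suc q) t n × P (u q) × Q (u (suc q + n))

    -- A passage through the mirror image of `w` has the same value as a reflected passage through
    -- `w`, which exists by mirror closure; only the latter need checking.
    reduce : ∀ q → Eqv (suc q) t n → (G : ℕ → Bool) → (∀ k k′ → Mir k k′ N → G k ≡ G k′) →
      (∀ k → ¬ Cong (suc k) t n → G k ≡ false) →
      (∀ k → Eqv (suc k) t n → occ N q k ≡ G k) → ∀ k → occ N q k ≡ G k
    reduce q g G mirror miss hit k = by (Cong? (suc k) t n)
      where
      by : Dec (Cong (suc k) t n) → occ N q k ≡ G k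
      by (no ¬w) = trans (occ-false {k} {q} (λ x → ¬w (Cong-trans (Cong-middle x) (inj₁ g)))) (sym (miss k ¬w))
      by (yes (inj₁ h)) = hit k h
      by (yes (inj₂ h)) with closed k N
      ... | k′ , m = trans (occ-cong (inj₂ m) q)
              (trans (hit k′ (Mir-Mir (Mir-sym (Mir-tail-init (Mir-init-tail m))) h)) (sym (mirror k k′ m)))

    edge-letters : ∀ {q} → Eqv (suc k) t n → Eqv (suc q) t n → Cong k q N → u k ≡ u q × u (suc k + n) ≡ u (suc q + n)
    edge-letters h g (inj₁ x) = Cong-cons h′ (inj₁ (Eqv-init (n≤1+n _) x)) , Cong-snoc h′ (inj₁ (Eqv-tail x))
      where h′ = Eqv-trans h (Eqv-sym g)
    edge-letters h g (inj₂ x) = contradiction (Eqv-Mir (Eqv-sym h) (Mir-Eqv (Mir-tail-init (Mir-init-tail x)) g)) ¬palw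

    letters-edge : ∀ {q} → Eqv (suc k) (suc q) n → u k ≡ u q → u (suc k + n) ≡ u (suc q + n) → Cong k q N
    letters-edge h e f = inj₁ (Eqv-cons e (Eqv-snoc h f))

    ¬shift : ∀ {q} → Eqv (suc k) (suc q) n → Eqv (suc q) t n → ¬ Cong (suc k) q (suc n)
    ¬shift h g x = ¬palw (Eqv-Mir (Eqv-sym g) (Mir-Eqv (Cong-shift⇒Mir h x) g))

    -- The right letter is a leaf of the bipartite graph of extensions: `wd` is always preceded by
    -- `c`. Crossing `cwd` thus means leaving `w` by `wd`, and the edge before `w` is never `wd`, as
    -- `w` is not a palindrome.
    leafʳ : ∀ q → Eqv (suc q) t n → ¬ Realised (_≢ u q) (_≡ u (suc q + n)) → CutsAt q
    leafʳ q g unrealised = trans (parity-cong F i)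
      (trans (passage-parity tree (suc q) t (inj₁ (inj₁ g)) i j cij) (sym (parity-cong F j)))
      where
      F : ∀ k → occ N q k ≡ passage n (suc q) t k
      F = reduce q g (passage n (suc q) t) (λ _ _ → passage-mirror (suc q)) (λ _ → passage-miss (suc q)) hit
        where
        hit : ∀ k → Eqv (suc k) t n → occ N q k ≡ passage n (suc q) t k
        hit k h = trans
          (does≡ (Cong? k q N) (Cong? (suc k) (suc q) (suc n)) (Cong? k (suc q) (suc n))
            (λ x → snoc-Cong h′ (proj₂ (edge-letters h g x))) back
            (λ x → ¬shift (Eqv-sym h′) h (Cong-sym x)))
          (trans (xor-comm (occ (suc n) (suc q) (suc k)) (occ (suc n) (suc q) k)) (sym (passage-hit (suc q) (inj₁ h))))
          where
          h′ = Eqv-trans h (Eqv-sym g)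
          back : Cong (suc k) (suc q) (suc n) → Cong k q N
          back x with u k Fin.≟ u q
          ... | yes e = letters-edge h′ e (Cong-snoc h′ x)
          ... | no ¬e = contradiction (k , h , ¬e , Cong-snoc h′ x) unrealised

    leafˡ : ∀ q → Eqv (suc q) t n → ¬ Realised (_≡ u q) (_≢ u (suc q + n)) → CutsAt q
    leafˡ q g unrealised = trans (parity-cong F i)
      (trans (passage-parity tree q t (inj₂ (inj₁ g)) i j cij) (sym (parity-cong F j)))
      where
      F : ∀ k → occ N q k ≡ passage n q t k
      F = reduce q g (passage n q t) (λ _ _ → passage-mirror q) (λ _ → passage-miss q) hit
        where
        hit : ∀ k → Eqv (suc k) t n → occ N q k ≡ passage n q t k
        hit k h = trans
          (does≡ (Cong? k q N) (Cong? k q (suc n)) (Cong? (suc k) q (suc n))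
            (λ x → cons-Cong h′ (proj₁ (edge-letters h g x))) back (¬shift h′ g))
          (sym (passage-hit q (inj₁ h)))
          where
          h′ = Eqv-trans h (Eqv-sym g)
          back : Cong k q (suc n) → Cong k q N
          back x with u (suc k + n) Fin.≟ u (suc q + n)
          ... | yes e = letters-edge h′ (Cong-cons h′ x) e
          ... | no ¬e = contradiction (k , h , Cong-cons h′ x , ¬e) unrealised

    -- With cwd and cwd′ the only edges at cw, crossing cwd means passing from
    -- cw through w without crossing cwd′, and the latter is a bridge by leafʳ.
    fork : ∀ q → Eqv (suc q) t n → u q ≡ u p → u (suc q + n) ≢ d → ¬ Realised (_≢ u p) (_≢ d) → CutsAt p
    fork q g c≡ d≢ unrealised = begin
      parity (occ N p) i                                    ≡⟨ split i ⟩
      parity (passage n p t) i xor parity (occ N q) i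
        ≡⟨ cong₂ _xor_ (passage-parity tree p t (inj₂ Cong-refl) i j cij) cut ⟩
      parity (passage n p t) j xor parity (occ N q) j       ≡⟨ sym (split j) ⟩
      parity (occ N p) j                                    ∎
      where
      open ≡-Reasoning
      cut : CutsAt q
      cut = leafʳ q g λ (k , h , ≢c , ≡d) → unrealised (k , h , (λ e → ≢c (trans e (sym c≡))) , (λ e → d≢ (trans (sym ≡d) e)))
      F : ∀ k → occ N p k ≡ passage n p t k xor occ N q k
      F = reduce p Eqv-refl (λ k → passage n p t k xor occ N q k)
            (λ k k′ m → cong₂ _xor_ (passage-mirror p m) (occ-cong (inj₂ m) q))
            (λ k ¬w → cong₂ _xor_ (passage-miss p ¬w) (occ-false {k} {q} (λ x → ¬w (Cong-trans (Cong-middle x) (inj₁ g))))) hit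
        where
        hit : ∀ k → Eqv (suc k) t n → occ N p k ≡ passage n p t k xor occ N q k
        hit k h = trans
          (does-xor (Cong? k p N) (Cong? k p (suc n)) (Cong? k q N)
            (λ x → inj₁ (cons-Cong h (proj₁ (edge-letters h Eqv-refl x)) ,
              λ y → d≢ (trans (sym (proj₂ (edge-letters h g y))) (proj₂ (edge-letters h Eqv-refl x)))))
            left
            (λ x y → contradiction (cons-Cong h (trans (proj₁ (edge-letters h g y)) c≡)) x))
          (cong (_xor occ N q k) (sym (trans (passage-hit p (inj₁ h))
            (trans (cong (occ (suc n) p k xor_) (occ-false {suc k} {p} (¬shift h Eqv-refl))) (xor-identityʳ (occ (suc n) p k))))))
          where
          left : Cong k p (suc n) → ¬ Cong k q N → Cong k p N
          left x y with u (suc k + n) Fin.≟ d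
          ... | yes e = letters-edge h (Cong-cons h x) e
          ... | no ¬e = contradiction (letters-edge (Eqv-trans h (Eqv-sym g)) (trans (Cong-cons h x) (sym c≡))
                          (binary _ _ _ ¬e (λ e → d≢ (sym e)))) y
      split : ∀ i → parity (occ N p) i ≡ parity (passage n p t) i xor parity (occ N q) i
      split i = trans (parity-cong F i) (parity-xor (passage n p t) (occ N q) i)

    strong : Realised (_≢ u p) (_≡ d) → Realised (_≡ u p) (_≢ d) → Realised (_≢ u p) (_≢ d) → Strong t n
    strong A B C a b with a Fin.≟ u p | b Fin.≟ d
    strong A B C a b | yes a≡ | yes b≡ = p , Eqv-refl , sym a≡ , sym b≡
    strong (q , h , x , y) B C a b | no a≢ | yes b≡ = q , h , binary _ _ _ x (λ e → a≢ (sym e)) , trans y (sym b≡)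
    strong A (q , h , x , y) C a b | yes a≡ | no b≢ = q , h , trans x (sym a≡) , binary _ _ _ y (λ e → b≢ (sym e))
    strong A B (q , h , x , y) a b | no a≢ | no b≢ =
      q , h , binary _ _ _ x (λ e → a≢ (sym e)) , binary _ _ _ y (λ e → b≢ (sym e))

    goal : ¬ ¬ CutsAt p
    -- The absence of any one of the three extensions other than `cwd` gives the goal; if all occur,
    -- `w` is strong.
    goal ¬cut = ¬cut (leafʳ p Eqv-refl λ A → ¬cut (leafˡ p Eqv-refl λ B@(q , g , c≡ , d≢) →
      ¬cut (fork q g c≡ d≢ λ C → noStrong t ¬palw (strong A B C))))

  -- Three edges of the cycle join the ends of `0w0`, and none of them is congruent to it because
  -- `w` is not a palindrome. So both ends have the same parity, while crossing `0w0` changes it.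
  Tree⇒¬Strong : Tree (suc n) → ∀ t → ¬ Mir t t n → ¬ Strong t n
  Tree⇒¬Strong {n} tree t ¬pal strong = contradiction even odd
    where
    q : Fin 2 → Fin 2 → ℕ
    q a b = proj₁ (strong a b)
    blk : ∀ a b → Eqv (suc (q a b)) t n
    blk a b = proj₁ (proj₂ (strong a b))
    fst : ∀ a b → u (q a b) ≡ a
    fst a b = proj₁ (proj₂ (proj₂ (strong a b)))
    lst : ∀ a b → u (suc (q a b) + n) ≡ b
    lst a b = proj₂ (proj₂ (proj₂ (strong a b)))
    o = zero
    I : Fin 2
    I = suc zero
    r = q o o
    f = occ (suc (suc n)) r
    ¬palp : ¬ Mir r r (suc (suc n))
    ¬palp m = ¬pal (Eqv-Mir (Eqv-sym (blk o o)) (Mir-Eqv (Mir-tail-init (Mir-init-tail m)) (blk o o)))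
    common : ∀ a b a′ b′ → Eqv (suc (q a b)) (suc (q a′ b′)) n
    common a b a′ b′ = Eqv-trans (blk a b) (Eqv-sym (blk a′ b′))
    left : ∀ a b b′ → parity f (q a b) ≡ parity f (q a b′)
    left a b b′ = tree r ¬palp _ _ (cons-Cong (common a b a b′) (trans (fst a b) (sym (fst a b′))))
    right : ∀ a a′ b → parity f (suc (q a b)) ≡ parity f (suc (q a′ b))
    right a a′ b = tree r ¬palp _ _ (snoc-Cong (common a b a′ b) (trans (lst a b) (sym (lst a′ b))))
    through : ∀ a b → ¬ (a ≡ o × b ≡ o) → parity f (q a b) ≡ parity f (suc (q a b))
    through a b ¬oo = sym (trans (cong (parity f (q a b) xor_) (occ-false {q a b} {r} differ)) (xor-identityʳ _))
      where
      differ : ¬ Cong (q a b) r (suc (suc n))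
      differ (inj₁ h) = ¬oo (trans (sym (fst a b)) (trans (Cong-cons (common a b o o) (inj₁ (Eqv-init (n≤1+n _) h))) (fst o o))
                            , trans (sym (lst a b)) (trans (Cong-snoc (common a b o o) (inj₁ (Eqv-tail h))) (lst o o)))
      differ (inj₂ h) = ¬pal (Eqv-Mir (Eqv-sym (blk a b)) (Mir-Eqv (Mir-tail-init (Mir-init-tail h)) (blk o o)))
    even : parity f (q o o) ≡ parity f (suc (q o o))
    even = begin
      parity f (q o o)        ≡⟨ left o o I ⟩
      parity f (q o I)        ≡⟨ through o I (λ ()) ⟩
      parity f (suc (q o I))  ≡⟨ right o I I ⟩
      parity f (suc (q I I))  ≡⟨ sym (through I I (λ ())) ⟩
      parity f (q I I)        ≡⟨ left I I o ⟩
      parity f (q I o)        ≡⟨ through I o (λ ()) ⟩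
      parity f (suc (q I o))  ≡⟨ right I o o ⟩
      parity f (suc (q o o))  ∎
      where open ≡-Reasoning
    flip : ∀ b → ¬ b ≡ b xor true
    flip false ()
    flip true ()
    odd : ¬ parity f (q o o) ≡ parity f (suc (q o o))
    odd e = flip _ (trans e (cong (parity f r xor_) (occ-true {r} {r} Cong-refl)))

-- Marked morphisms and the lift of words.

module _ {A : Set} where

  ++-split : ∀ (p {q} p′ {q′} : List A) → p ++ q ≡ p′ ++ q′ → length p ≡ length p′ → p ≡ p′ × q ≡ q′
  ++-split []      []       e _ = refl , e
  ++-split (x ∷ p) (y ∷ p′) e l with ∷-injective e
  ... | refl , e′ with ++-split p p′ e′ (suc-injective l)
  ...   | refl , e″ = refl , e″

  ++-prefix : ∀ (p {q} p′ {q′} : List A) → p ++ q ≡ p′ ++ q′ → length p ≤ length p′ → ∃ λ t → p′ ≡ p ++ t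
  ++-prefix []      p′       e _ = p′ , refl
  ++-prefix (x ∷ p) (y ∷ p′) e (s≤s l) with ∷-injective e
  ... | refl , e′ with ++-prefix p p′ e′ l
  ...   | t , refl = t , refl

module _ {k : ℕ} where

  first-difference : ∀ (x y : Word k) → length x ≡ length y → x ≢ y →
    ∃ λ v → ∃₂ λ c d → c ≢ d × (∃ λ r → x ≡ v ++ c ∷ r) × (∃ λ s → y ≡ v ++ d ∷ s)
  first-difference []      []      _ x≢y = contradiction refl x≢y
  first-difference (c ∷ x) (d ∷ y) l x≢y with c Fin.≟ d
  ... | no c≢d = [] , c , d , c≢d , (x , refl) , (y , refl)
  ... | yes refl with first-difference x y (suc-injective l) (λ e → x≢y (cong (c ∷_) e))
  ...   | v , c′ , d′ , c′≢d′ , (r , refl) , (s , refl) = c ∷ v , c′ , d′ , c′≢d′ , (r , refl) , (s , refl)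

  record Hom (φ : Word k → Word k) : Set where
    field
      ε-homo  : φ [] ≡ []
      ++-homo : ∀ x y → φ (x ++ y) ≡ φ x ++ φ y

    ∷-homo : ∀ c x → φ (c ∷ x) ≡ φ [ c ] ++ φ x
    ∷-homo c x = ++-homo [ c ] x

  mirror : (Word k → Word k) → Word k → Word k
  mirror φ x = reverse (φ (reverse x))

  mirror-Hom : ∀ {φ} → Hom φ → Hom (mirror φ)
  mirror-Hom {φ} h = record
    { ε-homo  = cong reverse ε-homo
    ; ++-homo = λ x y → trans (cong (reverse ∘ φ) (reverse-++ x y))
                  (trans (cong reverse (++-homo (reverse y) (reverse x))) (reverse-++ (φ (reverse y)) (φ (reverse x))))
    }
    where open Hom h

  -- After v, the images of two words with distinct first letters differ at once.
  record Marked (φ : Word k → Word k) : Set where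
    field
      hom         : Hom φ
      v           : Word k
      mark        : Fin k → Fin k
      mark-inj    : ∀ {c d} → mark c ≡ mark d → c ≡ d
      mark-letter : ∀ c → ∃ λ r → φ [ c ] ++ v ≡ v ++ mark c ∷ r

    open Hom hom public

    v-prefix : ∀ x → ∃ λ r → φ x ++ v ≡ v ++ r
    v-mark : ∀ c x → ∃ λ r → φ (c ∷ x) ++ v ≡ v ++ mark c ∷ r

    v-prefix []      = [] , trans (cong (_++ v) ε-homo) (sym (++-identityʳ v))
    v-prefix (c ∷ x) = _ , proj₂ (v-mark c x)

    v-mark c x with v-prefix x | mark-letter c
    ... | r , e | s , e′ = s ++ r , (begin
      φ (c ∷ x) ++ v            ≡⟨ cong (_++ v) (∷-homo c x) ⟩
      (φ [ c ] ++ φ x) ++ v     ≡⟨ ++-assoc (φ [ c ]) (φ x) v ⟩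
      φ [ c ] ++ φ x ++ v       ≡⟨ cong (φ [ c ] ++_) e ⟩
      φ [ c ] ++ v ++ r         ≡⟨ sym (++-assoc (φ [ c ]) v r) ⟩
      (φ [ c ] ++ v) ++ r       ≡⟨ cong (_++ r) e′ ⟩
      (v ++ mark c ∷ s) ++ r    ≡⟨ ++-assoc v (mark c ∷ s) r ⟩
      v ++ mark c ∷ s ++ r      ∎)
      where open ≡-Reasoning

    v-prefix-long : ∀ x → length v ≤ length (φ x) → ∃ λ r → φ x ≡ v ++ r
    v-prefix-long x l with v-prefix x
    ... | r , e = ++-prefix v (φ x) (sym e) l

    -- The letter after `v` in `φ (c ∷ x) ++ v` reveals `c`, whose image is then cancelled.
    injective : ∀ x y → φ x ≡ φ y → x ≡ y
    injective [] [] e = refl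
    injective [] (d ∷ y) e with v-mark d y
    ... | r , e′ with () ← ++-cancelˡ v [] _ (trans (++-identityʳ v) (trans (sym (cong (_++ v) (trans (sym e) ε-homo))) e′))
    injective (c ∷ x) [] e with v-mark c x
    ... | r , e′ with () ← ++-cancelˡ v [] _ (trans (++-identityʳ v) (trans (sym (cong (_++ v) (trans e ε-homo))) e′))
    injective (c ∷ x) (d ∷ y) e with v-mark c x | v-mark d y
    ... | r , e₁ | s , e₂ with mark-inj (∷-injectiveˡ (++-cancelˡ v _ _ (trans (sym e₁) (trans (cong (_++ v) e) e₂))))
    ...   | refl = cong (c ∷_) (injective x y (++-cancelˡ (φ [ c ]) _ _ (trans (sym (∷-homo c x)) (trans e (∷-homo c y)))))

  module Synchronised {φ ψ} (φ-marked : Marked φ) (ψ-hom : Hom ψ)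
    (lengths : ∀ c → length (φ [ c ]) ≡ length (ψ [ c ]))
    (h v₂ : Word k) (v≡ : Marked.v φ-marked ≡ h ++ v₂) where

    open Marked φ-marked
    module ψ = Hom ψ-hom

    h-prefix : ∀ x → ∃ λ s → φ x ++ h ≡ h ++ s
    h-prefix x with v-prefix x
    ... | r , e = ++-prefix h (φ x ++ h)
          (trans (sym (++-assoc h v₂ r)) (trans (cong (_++ r) (sym v≡))
            (trans (sym e) (trans (cong (φ x ++_) v≡) (sym (++-assoc (φ x) h v₂))))))
          (≤-trans (m≤n+m (length h) (length (φ x))) (≤-reflexive (sym (length-++ (φ x)))))

    -- The two parses of φ x h = g (ψ x) can be compared letter by letter because
    -- h is a prefix of φ y h for every y.
    sync : ∀ x g → length g ≡ length h → φ x ++ h ≡ g ++ ψ x →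
      ∀ {c} → c ∈ x → φ [ c ] ++ h ≡ h ++ ψ [ c ] × g ≡ h
    sync (c ∷ x) g |g| e with h-prefix x | h-prefix [ c ]
    ... | s , e₁ | s′ , e₂ = go
      where
      open ≡-Reasoning
      aligned : (φ [ c ] ++ h) ++ s ≡ (g ++ ψ [ c ]) ++ ψ x
      aligned = begin
        (φ [ c ] ++ h) ++ s     ≡⟨ ++-assoc (φ [ c ]) h s ⟩
        φ [ c ] ++ h ++ s       ≡⟨ cong (φ [ c ] ++_) (sym e₁) ⟩
        φ [ c ] ++ φ x ++ h     ≡⟨ sym (++-assoc (φ [ c ]) (φ x) h) ⟩
        (φ [ c ] ++ φ x) ++ h   ≡⟨ cong (_++ h) (sym (∷-homo c x)) ⟩
        φ (c ∷ x) ++ h          ≡⟨ e ⟩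
        g ++ ψ (c ∷ x)          ≡⟨ cong (g ++_) (ψ.∷-homo c x) ⟩
        g ++ ψ [ c ] ++ ψ x     ≡⟨ sym (++-assoc g (ψ [ c ]) (ψ x)) ⟩
        (g ++ ψ [ c ]) ++ ψ x   ∎
      same-length : length (φ [ c ] ++ h) ≡ length (g ++ ψ [ c ])
      same-length = begin
        length (φ [ c ] ++ h)            ≡⟨ length-++ (φ [ c ]) ⟩
        length (φ [ c ]) + length h      ≡⟨ cong₂ _+_ (lengths c) (sym |g|) ⟩
        length (ψ [ c ]) + length g      ≡⟨ +-comm (length (ψ [ c ])) (length g) ⟩
        length g + length (ψ [ c ])      ≡⟨ sym (length-++ g) ⟩
        length (g ++ ψ [ c ])            ∎
      cut = ++-split (φ [ c ] ++ h) (g ++ ψ [ c ]) aligned same-length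
      g≡h : g ≡ h
      g≡h = proj₁ (++-split g h (trans (sym (proj₁ cut)) e₂) |g|)
      go : ∀ {d} → d ∈ c ∷ x → φ [ d ] ++ h ≡ h ++ ψ [ d ] × g ≡ h
      go (here refl) = trans (proj₁ cut) (cong (_++ ψ [ c ]) g≡h) , g≡h
      go (there d∈x) = proj₁ (sync x h refl (trans e₁ (cong (h ++_) (proj₂ cut))) d∈x) , g≡h

    intertwine : (∀ c → φ [ c ] ++ h ≡ h ++ ψ [ c ]) → ∀ x → φ x ++ h ≡ h ++ ψ x
    intertwine l [] = trans (cong (_++ h) ε-homo) (sym (trans (cong (h ++_) ψ.ε-homo) (++-identityʳ h)))
    intertwine l (c ∷ x) = begin
      φ (c ∷ x) ++ h            ≡⟨ cong (_++ h) (∷-homo c x) ⟩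
      (φ [ c ] ++ φ x) ++ h     ≡⟨ ++-assoc (φ [ c ]) (φ x) h ⟩
      φ [ c ] ++ φ x ++ h       ≡⟨ cong (φ [ c ] ++_) (intertwine l x) ⟩
      φ [ c ] ++ h ++ ψ x       ≡⟨ sym (++-assoc (φ [ c ]) h (ψ x)) ⟩
      (φ [ c ] ++ h) ++ ψ x     ≡⟨ cong (_++ ψ x) (l c) ⟩
      (h ++ ψ [ c ]) ++ ψ x     ≡⟨ ++-assoc h (ψ [ c ]) (ψ x) ⟩
      h ++ ψ [ c ] ++ ψ x       ≡⟨ cong (h ++_) (sym (ψ.∷-homo c x)) ⟩
      h ++ ψ (c ∷ x)            ∎
      where open ≡-Reasoning

  -- Comparing margins gives `reverse v = reverse v₂ ++ g`, so `v = h ++ v₂` with `h = reverse g`,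
  -- and the hypothesis shrinks to `φ x ++ h = g ++ ψ x`. As `x` contains all letters, `sync` yields
  -- `g = h` and a conjugation of `φ` to `ψ` by `h` on every letter, hence on every word.
  agree : ∀ {φ ψ} (M : Marked φ) (ψ-hom : Hom ψ) → (∀ c → length (φ [ c ]) ≡ length (ψ [ c ])) →
    let v = Marked.v M in ∀ v₂ → length v₂ ≤ length v →
    ∀ x → (∀ c → c ∈ x) → reverse v₂ ++ φ x ++ v ≡ reverse v ++ ψ x ++ v₂ → 0 < length x →
    ∀ y → reverse v₂ ++ φ y ++ v ≡ reverse v ++ ψ y ++ v₂
  agree {φ} {ψ} M ψ-hom lengths v₂ v₂≤v x@(c₀ ∷ _) all e _ y
    with ++-prefix (reverse v₂) (reverse (Marked.v M)) e
           (≤-trans (≤-reflexive (length-reverse v₂)) (≤-trans v₂≤v (≤-reflexive (sym (length-reverse (Marked.v M))))))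
  ... | g , rv≡ = begin
      reverse v₂ ++ φ y ++ v                ≡⟨ cong (λ z → reverse v₂ ++ φ y ++ z) v≡ ⟩
      reverse v₂ ++ φ y ++ h ++ v₂          ≡⟨ cong (reverse v₂ ++_) (sym (++-assoc (φ y) h v₂)) ⟩
      reverse v₂ ++ (φ y ++ h) ++ v₂
        ≡⟨ cong (λ z → reverse v₂ ++ z ++ v₂) (intertwine (λ c → proj₁ (synced (all c))) y) ⟩
      reverse v₂ ++ (h ++ ψ y) ++ v₂        ≡⟨ cong (reverse v₂ ++_) (++-assoc h (ψ y) v₂) ⟩
      reverse v₂ ++ h ++ ψ y ++ v₂
        ≡⟨ cong (λ z → reverse v₂ ++ z ++ ψ y ++ v₂) (sym (proj₂ (synced (all c₀)))) ⟩
      reverse v₂ ++ g ++ ψ y ++ v₂          ≡⟨ sym (++-assoc (reverse v₂) g _) ⟩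
      (reverse v₂ ++ g) ++ ψ y ++ v₂        ≡⟨ cong (_++ ψ y ++ v₂) (sym rv≡) ⟩
      reverse v ++ ψ y ++ v₂                ∎
    where
    open ≡-Reasoning
    v = Marked.v M
    h = reverse g
    v≡ : v ≡ h ++ v₂
    v≡ = trans (sym (reverse-involutive v)) (trans (cong reverse rv≡)
           (trans (reverse-++ (reverse v₂) g) (cong (h ++_) (reverse-involutive v₂))))
    open Synchronised M ψ-hom lengths h v₂ v≡ using (sync; intertwine)
    e′ : (φ x ++ h) ++ v₂ ≡ (g ++ ψ x) ++ v₂
    e′ = begin
      (φ x ++ h) ++ v₂    ≡⟨ ++-assoc (φ x) h v₂ ⟩
      φ x ++ h ++ v₂      ≡⟨ cong (φ x ++_) (sym v≡) ⟩
      φ x ++ v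
        ≡⟨ ++-cancelˡ (reverse v₂) _ _ (trans e (trans (cong (_++ ψ x ++ v₂) rv≡) (++-assoc (reverse v₂) g _))) ⟩
      g ++ ψ x ++ v₂      ≡⟨ sym (++-assoc g (ψ x) v₂) ⟩
      (g ++ ψ x) ++ v₂    ∎
    synced : ∀ {c} → c ∈ x → φ [ c ] ++ h ≡ h ++ ψ [ c ] × g ≡ h
    synced = sync x g (sym (length-reverse g)) (++-cancelʳ v₂ _ _ e′)

  module Lift {φ} (M : Marked φ) (M′ : Marked (mirror φ)) where

    open Marked M
    module M′ = Marked M′
    v′ = M′.v

    -- `v′` belongs to the mirrored morphism and is read from right to left, hence the left margin
    -- `reverse v′`.
    lift : Word k → Word k
    lift x = reverse v′ ++ φ x ++ v

    lift-injective : ∀ x y → lift x ≡ lift y → x ≡ y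
    lift-injective x y e = injective x y (++-cancelʳ v _ _ (++-cancelˡ (reverse v′) _ _ e))

    -- Strength is inherited through this: the marks are injective, so over two letters every
    -- extension of `lift x` comes from one of `x`.
    lift-extend : ∀ c d x → ∃₂ λ l r → lift (c ∷ x ++ [ d ]) ≡ l ++ (M′.mark c ∷ lift x ++ [ mark d ]) ++ r
    lift-extend c d x with M′.mark-letter c | mark-letter d
    ... | l , el | r , er = reverse l , r , (begin
      reverse v′ ++ φ (c ∷ x ++ [ d ]) ++ v
        ≡⟨ cong (λ z → reverse v′ ++ z ++ v) (trans (∷-homo c (x ++ [ d ])) (cong (φ [ c ] ++_) (++-homo x [ d ]))) ⟩
      reverse v′ ++ (φ [ c ] ++ φ x ++ φ [ d ]) ++ v
        ≡⟨ cong (reverse v′ ++_) (trans (++-assoc (φ [ c ]) (φ x ++ φ [ d ]) v) (cong (φ [ c ] ++_) (++-assoc (φ x) (φ [ d ]) v))) ⟩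
      reverse v′ ++ φ [ c ] ++ φ x ++ φ [ d ] ++ v                ≡⟨ sym (++-assoc (reverse v′) (φ [ c ]) _) ⟩
      (reverse v′ ++ φ [ c ]) ++ φ x ++ φ [ d ] ++ v              ≡⟨ cong₂ (λ y z → y ++ φ x ++ z) left er ⟩
      (reverse l ++ M′.mark c ∷ reverse v′) ++ φ x ++ v ++ mark d ∷ r
        ≡⟨ ++-assoc (reverse l) (M′.mark c ∷ reverse v′) (φ x ++ v ++ mark d ∷ r) ⟩
      reverse l ++ M′.mark c ∷ reverse v′ ++ φ x ++ v ++ mark d ∷ r
        ≡⟨ cong (λ z → reverse l ++ M′.mark c ∷ z) right ⟩
      reverse l ++ M′.mark c ∷ (lift x ++ [ mark d ]) ++ r        ∎)
      where
      open ≡-Reasoning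
      left : reverse v′ ++ φ [ c ] ≡ reverse l ++ M′.mark c ∷ reverse v′
      left = begin
        reverse v′ ++ φ [ c ]                      ≡⟨ cong (reverse v′ ++_) (sym (reverse-involutive (φ [ c ]))) ⟩
        reverse v′ ++ reverse (mirror φ [ c ])     ≡⟨ sym (reverse-++ (mirror φ [ c ]) v′) ⟩
        reverse (mirror φ [ c ] ++ v′)             ≡⟨ cong reverse el ⟩
        reverse (v′ ++ M′.mark c ∷ l)              ≡⟨ reverse-++ v′ (M′.mark c ∷ l) ⟩
        reverse (M′.mark c ∷ l) ++ reverse v′      ≡⟨ cong (_++ reverse v′) (reverse-++ [ M′.mark c ] l) ⟩
        (reverse l ++ [ M′.mark c ]) ++ reverse v′ ≡⟨ ++-assoc (reverse l) [ M′.mark c ] (reverse v′) ⟩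
        reverse l ++ M′.mark c ∷ reverse v′        ∎
      right : reverse v′ ++ φ x ++ v ++ mark d ∷ r ≡ (lift x ++ [ mark d ]) ++ r
      right = sym (begin
        (lift x ++ [ mark d ]) ++ r                       ≡⟨ ++-assoc (lift x) [ mark d ] r ⟩
        (reverse v′ ++ φ x ++ v) ++ mark d ∷ r            ≡⟨ ++-assoc (reverse v′) (φ x ++ v) (mark d ∷ r) ⟩
        reverse v′ ++ (φ x ++ v) ++ mark d ∷ r
          ≡⟨ cong (reverse v′ ++_) (++-assoc (φ x) v (mark d ∷ r)) ⟩
        reverse v′ ++ φ x ++ v ++ mark d ∷ r              ∎)

    reverse-lift : ∀ x → reverse (lift x) ≡ reverse v ++ mirror φ (reverse x) ++ v′
    reverse-lift x = begin
      reverse (reverse v′ ++ φ x ++ v)               ≡⟨ reverse-++ (reverse v′) (φ x ++ v) ⟩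
      reverse (φ x ++ v) ++ reverse (reverse v′)     ≡⟨ cong₂ _++_ (reverse-++ (φ x) v) (reverse-involutive v′) ⟩
      (reverse v ++ reverse (φ x)) ++ v′             ≡⟨ ++-assoc (reverse v) (reverse (φ x)) v′ ⟩
      reverse v ++ reverse (φ x) ++ v′
        ≡⟨ cong (λ z → reverse v ++ reverse (φ z) ++ v′) (sym (reverse-involutive x)) ⟩
      reverse v ++ mirror φ (reverse x) ++ v′        ∎
      where open ≡-Reasoning

    -- Palindromicity of `x` and `lift x` says that `lift` and its mirrored version agree at `x`;
    -- `agree` spreads this to all words, with the two morphisms exchanged if `v′` is the longer
    -- margin.
    lift-reverse : ∀ x → (∀ c → c ∈ x) → 0 < length x → IsPalindrome x → IsPalindrome (lift x) →
      ∀ y → reverse (lift y) ≡ lift (reverse y)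
    lift-reverse x all 0<x pal palL y = trans (reverse-lift y) (sym (every (reverse y)))
      where
      at-x : lift x ≡ reverse v ++ mirror φ x ++ v′
      at-x = trans (sym palL) (trans (reverse-lift x) (cong (λ z → reverse v ++ mirror φ z ++ v′) pal))
      lengths : ∀ c → length (φ [ c ]) ≡ length (mirror φ [ c ])
      lengths c = sym (length-reverse (φ [ c ]))
      every : ∀ y → lift y ≡ reverse v ++ mirror φ y ++ v′
      every y with ≤-total (length v′) (length v)
      ... | inj₁ v′≤v = agree M M′.hom lengths v′ v′≤v x all at-x 0<x y
      ... | inj₂ v≤v′ = sym (agree M′ hom (λ c → sym (lengths c)) v v≤v′ x all (sym at-x) 0<x y)

-- v is the longest common prefix of φ (01) and φ (10).
noncommuting⇒Marked : ∀ {φ : Word 2 → Word 2} → Hom φ →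
  φ [ zero ] ++ φ [ suc zero ] ≢ φ [ suc zero ] ++ φ [ zero ] → Marked φ
noncommuting⇒Marked {φ} hom AB≢BA with first-difference _ _
  (trans (length-++ (φ [ zero ])) (trans (+-comm (length (φ [ zero ])) _) (sym (length-++ (φ [ suc zero ]))))) AB≢BA
... | v , c , d , c≢d , (r , AB≡) , (s , BA≡) = record
  { hom = hom
  ; v = v
  ; mark = λ { zero → c ; (suc zero) → d }
  ; mark-inj = λ { {zero} {zero} _ → refl ; {zero} {suc zero} e → contradiction e c≢d
                 ; {suc zero} {zero} e → contradiction (sym e) c≢d ; {suc zero} {suc zero} _ → refl }
  ; mark-letter = λ { zero → after A B A≢[] AB≡ BA≡ ; (suc zero) → after B A B≢[] BA≡ AB≡ }
  }
  where
  A = φ [ zero ]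
  B = φ [ suc zero ]
  A≢[] : A ≢ []
  A≢[] e = AB≢BA (trans (cong (_++ B) e) (trans (sym (++-identityʳ B)) (cong (B ++_) (sym e))))
  B≢[] : B ≢ []
  B≢[] e = AB≢BA (trans (cong (A ++_) e) (trans (++-identityʳ A) (cong (_++ A) (sym e))))
  -- Both `v ++ [ c ]` and `A ++ v` are prefixes of `A ++ B ++ A`, and the second is at least as
  -- long because `A` is not empty.
  after : ∀ (A B : Word 2) {c d r s} → A ≢ [] → A ++ B ≡ v ++ c ∷ r → B ++ A ≡ v ++ d ∷ s →
    ∃ λ t → A ++ v ≡ v ++ c ∷ t
  after [] B A≢[] _ _ = contradiction refl A≢[]
  after A@(_ ∷ A₁) B {c} {d} {r} {s} _ e e′ with ++-prefix (v ++ [ c ]) (A ++ v) both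
      (≤-trans (≤-reflexive (trans (length-++ v) (+-comm (length v) 1)))
        (s≤s (≤-trans (m≤n+m (length v) (length A₁)) (≤-reflexive (sym (length-++ A₁))))))
    where
    open ≡-Reasoning
    both : (v ++ [ c ]) ++ r ++ A ≡ (A ++ v) ++ d ∷ s
    both = begin
      (v ++ [ c ]) ++ r ++ A   ≡⟨ ++-assoc v [ c ] (r ++ A) ⟩
      v ++ (c ∷ r) ++ A        ≡⟨ sym (++-assoc v (c ∷ r) A) ⟩
      (v ++ c ∷ r) ++ A        ≡⟨ cong (_++ A) (sym e) ⟩
      (A ++ B) ++ A            ≡⟨ ++-assoc A B A ⟩
      A ++ B ++ A              ≡⟨ cong (A ++_) e′ ⟩
      A ++ v ++ d ∷ s          ≡⟨ sym (++-assoc A v (d ∷ s)) ⟩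
      (A ++ v) ++ d ∷ s        ∎
  ... | t , e″ = t , trans e″ (++-assoc v [ c ] t)

-- Enumeration of factors and bounded search.

module _ {A : Set} where

  Unique-⊆⇒length≤ : ∀ {xs ys : List A} → Unique xs → (∀ {x} → x ∈ xs → x ∈ ys) → length xs ≤ length ys
  Unique-⊆⇒length≤ [] _ = z≤n
  Unique-⊆⇒length≤ {x ∷ xs} (x∉xs ∷ uniq) sub with ∈-∃++ (sub (here refl))
  ... | as , bs , refl = ≤-trans (s≤s (Unique-⊆⇒length≤ uniq sub′)) (≤-reflexive (sym len))
    where
    len : length (as ++ x ∷ bs) ≡ suc (length (as ++ bs))
    len = trans (length-++ as) (trans (+-suc (length as) (length bs)) (cong suc (sym (length-++ as))))
    sub′ : ∀ {y} → y ∈ xs → y ∈ as ++ bs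
    sub′ y∈xs with ∈-++⁻ as (sub (there y∈xs))
    ... | inj₁ y∈as         = ∈-++⁺ˡ y∈as
    ... | inj₂ (here refl)  = contradiction refl (All.lookup x∉xs y∈xs)
    ... | inj₂ (there y∈bs) = ∈-++⁺ʳ as y∈bs

  applyUpTo-≗⁺ : ∀ (f g : ℕ → A) n → (∀ m → m < n → f m ≡ g m) → applyUpTo f n ≡ applyUpTo g n
  applyUpTo-≗⁺ f g zero    h = refl
  applyUpTo-≗⁺ f g (suc n) h = cong₂ _∷_ (h 0 (s≤s z≤n)) (applyUpTo-≗⁺ (f ∘ suc) (g ∘ suc) n (λ m m<n → h (suc m) (s≤s m<n)))

  applyUpTo-≗⁻ : ∀ (f g : ℕ → A) n → applyUpTo f n ≡ applyUpTo g n → ∀ m → m < n → f m ≡ g m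
  applyUpTo-≗⁻ f g (suc n) e zero    _         = ∷-injectiveˡ e
  applyUpTo-≗⁻ f g (suc n) e (suc m) (s≤s m<n) = applyUpTo-≗⁻ (f ∘ suc) (g ∘ suc) n (∷-injectiveʳ e) m m<n

  applyUpTo-down⁺ : ∀ (f g : ℕ → A) n → (∀ m m′ → suc (m + m′) ≡ n → f m ≡ g m′) → applyUpTo f n ≡ applyDownFrom g n
  applyUpTo-down⁺ f g zero    h = refl
  applyUpTo-down⁺ f g (suc n) h = cong₂ _∷_ (h 0 n refl) (applyUpTo-down⁺ (f ∘ suc) g n (λ m m′ e → h (suc m) m′ (cong suc e)))

  applyUpTo-down⁻ : ∀ (f g : ℕ → A) n → applyUpTo f n ≡ applyDownFrom g n → ∀ m m′ → suc (m + m′) ≡ n → f m ≡ g m′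
  applyUpTo-down⁻ f g (suc n) e zero    m′ refl = ∷-injectiveˡ e
  applyUpTo-down⁻ f g (suc n) e (suc m) m′ eq   = applyUpTo-down⁻ (f ∘ suc) g n (∷-injectiveʳ e) m m′ (suc-injective eq)

  ∈-inits⁺ : ∀ (f : ℕ → A) n l → l ≤ n → applyUpTo f l ∈ inits (applyUpTo f n)
  ∈-inits⁺ f n       zero    _         = here refl
  ∈-inits⁺ f (suc n) (suc l) (s≤s l≤n) with ∈-inits⁺ (f ∘ suc) n l l≤n
  ... | here e  = there (here (cong (f 0 ∷_) e))
  ... | there x = there (there (∈-map⁺ (f 0 ∷_) x))

  ∈-inits⁻ : ∀ (f : ℕ → A) n {p} → p ∈ inits (applyUpTo f n) → ∃ λ l → l ≤ n × p ≡ applyUpTo f l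
  ∈-inits⁻ f n       (here refl)         = 0 , z≤n , refl
  ∈-inits⁻ f (suc n) (there (here refl)) = 1 , s≤s z≤n , refl
  ∈-inits⁻ f (suc n) (there (there x)) with ∈-map⁻ (f 0 ∷_) x
  ... | q , q∈ , refl with ∈-inits⁻ (f ∘ suc) n (there q∈)
  ...   | l , l≤n , refl = suc l , s≤s l≤n , refl

  ∈-tails⁺ : ∀ (f : ℕ → A) i o → applyUpTo (λ j → f (i + j)) o ∈ tails (applyUpTo f (i + o))
  ∈-tails⁺ f zero    o = here refl
  ∈-tails⁺ f (suc i) o = there (∈-tails⁺ (f ∘ suc) i o)

  ∈-tails⁻ : ∀ (f : ℕ → A) n {p} → p ∈ tails (applyUpTo f n) → ∃₂ λ i o → i + o ≡ n × p ≡ applyUpTo (λ j → f (i + j)) o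
  ∈-tails⁻ f n (here refl) = 0 , n , refl , refl
  ∈-tails⁻ f (suc n) (there x) with ∈-tails⁻ (f ∘ suc) n x
  ... | i , o , refl , refl = suc i , o , refl , refl

module _ {P : ℕ → Set} (P? : ∀ n → Dec (P n)) where

  least : ∀ n → P n → ∃ λ m → m ≤ n × P m × (∀ k → k < m → ¬ P k)
  least n = go n n ≤-refl
    where
    go : ∀ b n → n ≤ b → P n → ∃ λ m → m ≤ n × P m × (∀ k → k < m → ¬ P k)
    go b n n≤b pn with anyUpTo? P? n
    go b n n≤b pn | no none = n , ≤-refl , pn , λ k k<n pk → none (k , k<n , pk)
    go zero zero z≤n pn | yes (k , () , pk)
    go (suc b) n n≤b pn | yes (k , k<n , pk) with go b k (s≤s⁻¹ (≤-trans k<n n≤b)) pk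
    ... | m , m≤k , pm , min = m , ≤-trans m≤k (<⇒≤ k<n) , pm , min

  greatest : ∀ b → ∃ (λ i → i < b × P i) → ∃ λ i → i < b × P i × (∀ k → i < k → k < b → ¬ P k)
  greatest (suc b) (i , i<b , pi) with P? b
  ... | yes pb = b , n<1+n b , pb , λ k b<k k<sb _ → contradiction (≤-trans k<sb b<k) (<-irrefl refl)
  ... | no ¬pb with m≤n⇒m<n∨m≡n (s≤s⁻¹ i<b)
  ...   | inj₂ refl = contradiction pi ¬pb
  ...   | inj₁ i<b′ with greatest b (i , i<b′ , pi)
  ...     | j , j<b , pj , max = j , m≤n⇒m≤1+n j<b , pj , λ k j<k k<sb pk →
              [ (λ k<b → max k j<k k<b pk) , (λ { refl → ¬pb pk }) ]′ (m≤n⇒m<n∨m≡n (s≤s⁻¹ k<sb))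

  failures : ℕ → ℕ
  failures zero = 0
  failures (suc n) with P? n
  ... | yes _ = failures n
  ... | no  _ = suc (failures n)

  failures-suc : ∀ n → failures n ≤ failures (suc n)
  failures-suc n with P? n
  ... | yes _ = ≤-refl
  ... | no  _ = n≤1+n _

  failures-no : ∀ n → ¬ P n → failures (suc n) ≡ suc (failures n)
  failures-no n ¬pn with P? n
  ... | yes pn = contradiction pn ¬pn
  ... | no  _  = refl

  failures-mono : ∀ n d → failures n ≤ failures (n + d)
  failures-mono n zero    = ≤-reflexive (cong failures (sym (+-identityʳ n)))
  failures-mono n (suc d) = ≤-trans (failures-mono n d)
    (≤-trans (failures-suc (n + d)) (≤-reflexive (cong failures (sym (+-suc n d)))))

  -- If the failures never stopped, more than `N` of them would be met. The last one cannot be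
  -- located, hence the double negation.
  eventually : ∀ N → (∀ n → failures n ≤ N) → ¬ ¬ (∃ λ n₀ → ∀ n → n₀ ≤ n → P n)
  eventually N bound ¬ev = many (suc N) λ (n , N<) → contradiction (≤-trans N< (bound n)) (<-irrefl refl)
    where
    many : ∀ c → ¬ ¬ (∃ λ n → c ≤ failures n)
    many zero    k = k (0 , z≤n)
    many (suc c) k = many c λ (n , c≤) → ¬ev (n , λ m n≤m → holds n c≤ m (m≤n⇒∃[o]m+o≡n n≤m))
      where
      holds : ∀ n → c ≤ failures n → ∀ m → ∃ (λ d → n + d ≡ m) → P m
      holds n c≤ m (d , refl) with P? m
      ... | yes pm = pm
      ... | no ¬pm = contradiction
              (suc m , ≤-trans (s≤s (≤-trans c≤ (failures-mono n d))) (≤-reflexive (sym (failures-no m ¬pm)))) k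

-- Counting the palindromes of prefixes.

module Defects {a : ℕ} (u : InfWord a) where
  open Blocks u

  private
    variable
      i j l n : ℕ

  factorAt⇒Eqv : factorAt u i n ≡ factorAt u j n → Eqv i j n
  factorAt⇒Eqv {i} {n} {j} = applyUpTo-≗⁻ (λ m → u (i + m)) (λ m → u (j + m)) n

  Eqv⇒factorAt : Eqv i j n → factorAt u i n ≡ factorAt u j n
  Eqv⇒factorAt {i} {j} {n} = applyUpTo-≗⁺ (λ m → u (i + m)) (λ m → u (j + m)) n

  reverse⇒Mir : reverse (factorAt u j n) ≡ factorAt u i n → Mir i j n
  reverse⇒Mir {j} {n} {i} e = applyUpTo-down⁻ (λ m → u (i + m)) (λ m → u (j + m)) n
    (trans (sym e) (reverse-applyUpTo (λ m → u (j + m)) n))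

  Mir⇒reverse : Mir i j n → reverse (factorAt u j n) ≡ factorAt u i n
  Mir⇒reverse {i} {j} {n} h = trans (reverse-applyUpTo (λ m → u (j + m)) n)
    (sym (applyUpTo-down⁺ (λ m → u (i + m)) (λ m → u (j + m)) n h))

  length-factorAt : ∀ i n → length (factorAt u i n) ≡ n
  length-factorAt i n = length-applyUpTo (λ m → u (i + m)) n

  pals : ℕ → List (Word a)
  pals n = palindromicFactors (prefix u n)

  pals-unique : ∀ n → Unique (pals n)
  pals-unique n = Unique.deduplicate-! _≟ʷ_ (filter isPalindrome? (factors (prefix u n)))

  ∈-pals⁺ : i + l ≤ n → Mir i i l → factorAt u i l ∈ pals n
  ∈-pals⁺ {i} {l} {n} le pal with m≤n⇒∃[o]m+o≡n le
  ... | o , refl = ∈-deduplicate⁺ _≟ʷ_ (∈-filter⁺ isPalindrome?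
        (∈-concatMap⁺ inits (lose (subst (λ z → factorAt u i (l + o) ∈ tails (prefix u z)) (sym (+-assoc i l o)) (∈-tails⁺ u i (l + o)))
          (∈-inits⁺ (λ m → u (i + m)) (l + o) l (m≤m+n l o)))) (Mir⇒reverse pal))

  ∈-pals⁻ : ∀ n {p} → p ∈ pals n → ∃₂ λ i l → i + l ≤ n × p ≡ factorAt u i l × Mir i i l
  ∈-pals⁻ n {p} p∈ with ∈-filter⁻ isPalindrome? {xs = factors (prefix u n)} (∈-deduplicate⁻ _≟ʷ_ _ p∈)
  ... | p∈f , pal with find (∈-concatMap⁻ inits p∈f)
  ...   | t , t∈ , p∈t with ∈-tails⁻ u n t∈
  ...     | i , o , refl , refl with ∈-inits⁻ (λ m → u (i + m)) o p∈t
  ...       | l , l≤o , refl = i , l , +-monoʳ-≤ i l≤o , refl , reverse⇒Mir pal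

  factorAt-injective : ∀ {i j l m} → factorAt u i l ≡ factorAt u j m → l ≡ m × Eqv i j l
  factorAt-injective {i} {j} {l} {m} e with trans (sym (length-factorAt i l)) (trans (cong length e) (length-factorAt j m))
  ... | refl = refl , factorAt⇒Eqv e

  NewAt? : ∀ s l → Dec (NewAt s l)
  NewAt? s l = Mir? s s l ×-dec map′ (λ h i i<s e → h (i , i<s , e)) (λ h (i , i<s , e) → h i i<s e)
    (¬? (anyUpTo? (λ i → Eqv? i s l) s))

  NewPalSuffix? : ∀ n → Dec (NewPalSuffix n)
  NewPalSuffix? n = map′
    (λ (s , s≤n , h) → s , n ∸ s , m+[n∸m]≡n (s≤s⁻¹ s≤n) , h)
    (λ { (s , l , refl , h) → s , s≤s (m≤m+n s l) , subst (NewAt s) (sym (m+n∸m≡n s l)) h })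
    (anyUpTo? (λ s → NewAt? s (n ∸ s)) (suc n))

  -- The shorter of two palindromic suffixes is also a prefix of the longer one, so it has occurred
  -- before.
  NewAt-unique : ∀ {s l t m} → s + l ≡ t + m → NewAt s l → NewAt t m → s ≡ t
  NewAt-unique {s} {l} {t} {m} e (pal , new) (pal′ , new′) with <-cmp s t
  ... | tri≈ _ s≡t _ = s≡t
  ... | tri< s<t _ _ = ⊥-elim (new′ s s<t (Mir-Mir (Mir-sub pal ≤-refl (<⇒≤ s<t)
          (trans (+-assoc s t m) (trans (cong (s +_) (sym e)) (sym (+-assoc s s l))))) pal′))
  ... | tri> _ _ t<s = ⊥-elim (new t t<s (Mir-Mir (Mir-sub pal′ ≤-refl (<⇒≤ t<s)
          (trans (+-assoc t s l) (trans (cong (t +_) e) (sym (+-assoc t t m))))) pal))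

  NewAt⇒∉pals : ∀ {s l} → s + l ≡ suc n → NewAt s l → factorAt u s l ∉ pals n
  NewAt⇒∉pals {n} {s} {l} e (_ , new) P∈ with ∈-pals⁻ n P∈
  ... | i , m , i+m≤n , P≡ , _ with factorAt-injective P≡
  ...   | refl , h = new i (+-cancelʳ-< l i s (≤-trans (s≤s i+m≤n) (≤-reflexive (sym e)))) (Eqv-sym h)

  pals-suc⁻ : ∀ {p} → p ∈ pals (suc n) → p ∈ pals n ⊎ ∃₂ λ s l → s + l ≡ suc n × p ≡ factorAt u s l × NewAt s l
  pals-suc⁻ {n} p∈ with ∈-pals⁻ (suc n) p∈
  ... | i , l , le , refl , pal with m≤n⇒m<n∨m≡n le
  ...   | inj₁ i+l<sn = inj₁ (∈-pals⁺ (s≤s⁻¹ i+l<sn) pal)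
  ...   | inj₂ e with anyUpTo? (λ i′ → Eqv? i′ i l) i
  ...     | no none = inj₂ (i , l , e , refl , pal , λ i′ i′<i h → none (i′ , i′<i , h))
  ...     | yes (i′ , i′<i , h) = inj₁ (subst (_∈ pals n) (Eqv⇒factorAt h)
              (∈-pals⁺ (s≤s⁻¹ (≤-trans (+-monoˡ-< l i′<i) (≤-reflexive e))) (Eqv-Mir h (Mir-Eqv pal (Eqv-sym h)))))

  pals-mono : ∀ {p} → p ∈ pals n → p ∈ pals (suc n)
  pals-mono {n} p∈ with ∈-pals⁻ n p∈
  ... | i , l , le , refl , pal = ∈-pals⁺ (m≤n⇒m≤1+n le) pal

  new⇒pals-grow : NewPalSuffix (suc n) → length (pals n) < length (pals (suc n))
  new⇒pals-grow {n} (s , l , e , new) = Unique-⊆⇒length≤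
    (¬Any⇒All¬ (pals n) (NewAt⇒∉pals e new) ∷ pals-unique n)
    λ { (here refl) → ∈-pals⁺ (≤-reflexive e) (proj₁ new) ; (there p∈) → pals-mono p∈ }

  pals-suc≤ : ∀ n → length (pals (suc n)) ≤ suc (length (pals n))
  pals-suc≤ n with NewPalSuffix? (suc n)
  ... | no ¬new = m≤n⇒m≤1+n (Unique-⊆⇒length≤ (pals-unique (suc n))
        λ p∈ → [ (λ x → x) , (λ (s , l , e , _ , new) → contradiction (s , l , e , new) ¬new) ]′ (pals-suc⁻ p∈))
  ... | yes (s , l , e , new) = Unique-⊆⇒length≤ {ys = factorAt u s l ∷ pals n} (pals-unique (suc n)) (λ p∈ → sub (pals-suc⁻ p∈))
    where
    sub : ∀ {p} → p ∈ pals n ⊎ (∃₂ λ t m → t + m ≡ suc n × p ≡ factorAt u t m × NewAt t m) → p ∈ factorAt u s l ∷ pals n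
    sub (inj₁ p∈) = there p∈
    sub (inj₂ (t , m , e′ , refl , new′)) with NewAt-unique (trans e (sym e′)) new new′
    ... | refl = here (cong (factorAt u s) (+-cancelˡ-≡ s m l (trans e′ (sym e))))

  ¬new⇒pals-stay : ¬ NewPalSuffix (suc n) → length (pals (suc n)) ≤ length (pals n)
  ¬new⇒pals-stay {n} ¬new = Unique-⊆⇒length≤ (pals-unique (suc n))
    λ p∈ → [ (λ x → x) , (λ (s , l , e , _ , new) → contradiction (s , l , e , new) ¬new) ]′ (pals-suc⁻ p∈)

  lacunas : ℕ → ℕ
  lacunas = failures (λ n → NewPalSuffix? (suc n))

  -- Each letter adds at most one palindrome, and none at a lacuna; the extra 1 is the empty word.
  lacunas≤ : ∀ n → length (pals n) + lacunas n ≤ suc n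
  lacunas≤ zero = ≤-refl
  lacunas≤ (suc n) with NewPalSuffix? (suc n)
  ... | yes _  = ≤-trans (+-monoˡ-≤ (lacunas n) (pals-suc≤ n)) (s≤s (lacunas≤ n))
  ... | no ¬new = ≤-trans (+-monoˡ-≤ (suc (lacunas n)) (¬new⇒pals-stay ¬new))
        (≤-trans (≤-reflexive (+-suc (length (pals n)) (lacunas n))) (s≤s (lacunas≤ n)))

  finite-defect⇒new : HasFiniteDefect u → ¬ ¬ (∃ λ n₀ → ∀ n → n₀ ≤ n → NewPalSuffix n)
  finite-defect⇒new (N , bound) ¬new = eventually (λ n → NewPalSuffix? (suc n)) N lac
    -- Index `n` of `eventually` stands for the prefix of length `suc n`, hence the threshold
    -- `suc n₀`.
    λ (n₀ , h) → ¬new (suc n₀ , λ { (suc n) (s≤s n₀≤n) → h n n₀≤n })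
    where
    lac : ∀ n → lacunas n ≤ N
    lac n = ≤-trans (m+n≤o⇒m≤o∸n (lacunas n) (≤-trans (≤-reflexive (+-comm (lacunas n) (length (pals n)))) (lacunas≤ n)))
      (subst (λ z → suc z ∸ length (pals n) ≤ N) (length-factorAt 0 n) (bound (prefix u n) (0 , n , refl)))

  new⇒defect-0 : (∀ n → NewPalSuffix n) → ∀ n → defect (prefix u n) ≤ 0
  new⇒defect-0 new n = ≤-reflexive (m≤n⇒m∸n≡0 (≤-trans (≤-reflexive (cong suc (length-factorAt 0 n))) (all n)))
    where
    all : ∀ n → suc n ≤ length (pals n)
    all zero    = ≤-refl
    all (suc n) = ≤-trans (s≤s (all n)) (new⇒pals-grow (new (suc n)))

  -- The longest palindromic suffix, at worst the empty one, is new: from its last earlier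
  -- occurrence would start a complete return, a longer palindromic suffix.
  PalReturns⇒new : (∀ n → PalReturns n) → ∀ n → NewPalSuffix n
  PalReturns⇒new ret n with least (λ s → Mir? s s (n ∸ s)) n (subst (Mir n n) (sym (n∸n≡0 n)) (λ _ _ ()))
  ... | s , s≤n , pal , min = s , n ∸ s , m+[n∸m]≡n s≤n , pal , λ i i<s h →
    absurd (greatest (λ i → Eqv? i s (n ∸ s)) s (i , i<s , h))
    where
    absurd : ¬ ∃ λ i → i < s × Eqv i s (n ∸ s) × (∀ k → i < k → k < s → ¬ Eqv k s (n ∸ s))
    absurd (i , i<s , h , max) = min i i<s (ret (n ∸ s) i s i<s (inj₁ h)
      (λ k i<k k<s c → max k i<k k<s ([ (λ x → x) , (λ m → Mir-Mir m pal) ]′ c)) (n ∸ i)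
      (trans (m+[n∸m]≡n (≤-trans (<⇒≤ i<s) s≤n)) (sym (m+[n∸m]≡n s≤n))))

-- Passing between positions and words, and shifted words.

module Factors {a : ℕ} (u : InfWord a) where
  open Blocks u
  open Defects u

  factorAt-suc : ∀ i n → factorAt u i (suc n) ≡ u i ∷ factorAt u (suc i) n
  factorAt-suc i n = cong₂ _∷_ (cong u (+-identityʳ i)) (applyUpTo-≗⁺ _ _ n (λ m _ → cong u (+-suc i m)))

  factorAt-+ : ∀ i m n → factorAt u i (m + n) ≡ factorAt u i m ++ factorAt u (i + m) n
  factorAt-+ i zero    n = cong (λ z → factorAt u z n) (sym (+-identityʳ i))
  factorAt-+ i (suc m) n = begin
    factorAt u i (suc (m + n))                                    ≡⟨ factorAt-suc i (m + n) ⟩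
    u i ∷ factorAt u (suc i) (m + n)                              ≡⟨ cong (u i ∷_) (factorAt-+ (suc i) m n) ⟩
    u i ∷ factorAt u (suc i) m ++ factorAt u (suc i + m) n
      ≡⟨ cong₂ _++_ (sym (factorAt-suc i m)) (cong (λ z → factorAt u z n) (sym (+-suc i m))) ⟩
    factorAt u i (suc m) ++ factorAt u (i + suc m) n              ∎
    where open ≡-Reasoning

  factorAt-split : ∀ i n xs {ys} → factorAt u i n ≡ xs ++ ys →
    xs ≡ factorAt u i (length xs) × ys ≡ factorAt u (i + length xs) (length ys)
  factorAt-split i n xs {ys} e = ++-split xs (factorAt u i (length xs)) both (sym (length-factorAt i (length xs)))
    where
    n≡ : n ≡ length xs + length ys
    n≡ = trans (sym (length-factorAt i n)) (trans (cong length e) (length-++ xs))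
    both : xs ++ ys ≡ factorAt u i (length xs) ++ factorAt u (i + length xs) (length ys)
    both = trans (sym e) (trans (cong (factorAt u i) n≡) (factorAt-+ i (length xs) (length ys)))

  factorAt-infix : ∀ i n xs ys {zs} → factorAt u i n ≡ xs ++ ys ++ zs → ys ≡ factorAt u (i + length xs) (length ys)
  factorAt-infix i n xs ys e = proj₁ (factorAt-split _ _ ys (sym (proj₂ (factorAt-split i n xs e))))

  infix-IsFactorOf : ∀ xs ys {zs} → (xs ++ ys ++ zs) IsFactorOf u → ys IsFactorOf u
  infix-IsFactorOf xs ys (i , n , e) = _ , _ , factorAt-infix i n xs ys (sym e)

  letterAt : ∀ i n xs {c ys} → factorAt u i n ≡ xs ++ c ∷ ys → c ≡ u (i + length xs)
  letterAt i n xs {c} e = trans (∷-injectiveˡ (factorAt-infix i n xs [ c ] e)) (cong u (+-identityʳ _))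

  StrongWord : Word a → Set
  StrongWord w = ∀ c d → (c ∷ w ++ [ d ]) IsFactorOf u

  Strong⇒StrongWord : ∀ {t n} → Strong t n → StrongWord (factorAt u t n)
  Strong⇒StrongWord {t} {n} s c d with s c d
  ... | q , h , refl , refl = q , suc (n + 1) , sym (begin
      factorAt u q (suc (n + 1))                             ≡⟨ factorAt-suc q (n + 1) ⟩
      u q ∷ factorAt u (suc q) (n + 1)                       ≡⟨ cong (u q ∷_) (factorAt-+ (suc q) n 1) ⟩
      u q ∷ factorAt u (suc q) n ++ [ u (suc q + n + 0) ]
        ≡⟨ cong₂ (λ y z → u q ∷ y ++ [ u z ]) (Eqv⇒factorAt h) (+-identityʳ _) ⟩
      u q ∷ factorAt u t n ++ [ u (suc q + n) ]              ∎)
      where open ≡-Reasoning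

  StrongWord⇒Strong : ∀ {t n} → StrongWord (factorAt u t n) → Strong t n
  StrongWord⇒Strong {t} {n} s c d with s c d
  ... | q , N , e = q , factorAt⇒Eqv (sym w≡) ,
        sym (trans (letterAt q N [] (sym e)) (cong u (+-identityʳ q))) ,
        sym (trans (letterAt q N (c ∷ w) (sym e)) (cong u (trans (cong (λ z → q + suc z) |w|) (+-suc q n))))
    where
    w = factorAt u t n
    |w| = length-factorAt t n
    w≡ : w ≡ factorAt u (suc q) n
    w≡ = trans (factorAt-infix q N [ c ] w (sym e)) (cong₂ (factorAt u) (+-comm q 1) |w|)

module Shift {a : ℕ} (u : InfWord a) (o : ℕ) where
  private
    module U = Blocks u
    v : InfWord a
    v j = u (o + j)
    module V = Blocks v

  shift-Eqv : ∀ {i j n} → V.Eqv i j n → U.Eqv (o + i) (o + j) n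
  shift-Eqv {i} {j} h m m<n = trans (cong u (+-assoc o i m)) (trans (h m m<n) (cong u (sym (+-assoc o j m))))

  shift-Mir : ∀ {i j n} → V.Mir i j n → U.Mir (o + i) (o + j) n
  shift-Mir {i} {j} h m m′ e = trans (cong u (+-assoc o i m)) (trans (h m m′ e) (cong u (sym (+-assoc o j m′))))

  unshift-Eqv : ∀ {i j n} → U.Eqv (o + i) (o + j) n → V.Eqv i j n
  unshift-Eqv {i} {j} h m m<n = trans (cong u (sym (+-assoc o i m))) (trans (h m m<n) (cong u (+-assoc o j m)))

  unshift-Mir : ∀ {i j n} → U.Mir (o + i) (o + j) n → V.Mir i j n
  unshift-Mir {i} {j} h m m′ e = trans (cong u (sym (+-assoc o i m))) (trans (h m m′ e) (cong u (+-assoc o j m′)))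

  unshift-Cong : ∀ {i j n} → U.Cong (o + i) (o + j) n → V.Cong i j n
  unshift-Cong = [ (λ x → inj₁ (unshift-Eqv x)) , (λ x → inj₂ (unshift-Mir x)) ]′

  shift-Cong : ∀ {i j n} → V.Cong i j n → U.Cong (o + i) (o + j) n
  shift-Cong = [ (λ x → inj₁ (shift-Eqv x)) , (λ x → inj₂ (shift-Mir x)) ]′

  -- A factor is a prefix of a shifted word, so this extends the count made on prefixes to all
  -- factors.
  shift-PalReturns : ∀ {n} → U.PalReturns n → V.PalReturns n
  shift-PalReturns {n} ret i j i<j c none L e = unshift-Mir
    (ret (o + i) (o + j) (+-monoʳ-< o i<j) (shift-Cong c) none′ L
      (trans (+-assoc o i L) (trans (cong (o +_) e) (sym (+-assoc o j n)))))
    where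
    none′ : ∀ k → o + i < k → k < o + j → ¬ U.Cong k (o + j) n
    none′ k i<k k<j c′ with m≤n⇒∃[o]m+o≡n (≤-trans (m≤m+n o i) (<⇒≤ i<k))
    ... | k′ , refl = none k′ (+-cancelˡ-< o i k′ i<k) (+-cancelˡ-< o k′ j k<j) (unshift-Cong c′)

-- The word fixed by the morphism.

distinct⇒2≤length : ∀ {A : Set} {x y : A} {xs} → x ≢ y → x ∈ xs → y ∈ xs → 2 ≤ length xs
distinct⇒2≤length x≢y (here refl) (here refl) = contradiction refl x≢y
distinct⇒2≤length {xs = _ ∷ _ ∷ _} _ _ _ = s≤s (s≤s z≤n)
distinct⇒2≤length {xs = _ ∷ []} _ (there ()) _
distinct⇒2≤length {xs = _ ∷ []} _ (here _) (there ())

preimage : (f : Fin 2 → Fin 2) → (∀ {c d} → f c ≡ f d → c ≡ d) → ∀ c → ∃ λ b → f b ≡ c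
preimage f inj c with f zero Fin.≟ c | f (suc zero) Fin.≟ c
... | yes e | _     = zero , e
... | no _  | yes e = suc zero , e
... | no ¬e | no ¬e′ with () ← inj {zero} {suc zero} (binary _ _ _ ¬e (λ e → ¬e′ (sym e)))

module Expanding {π : Word 2 → Word 2} (hom : Hom π) (full : ∀ a b → b ∈ π [ a ])
  (u : InfWord 2) (stable : ∀ n → ∃ λ N → π (prefix u n) ≡ prefix u N) where

  open Hom hom
  open Blocks u
  open BinaryBlocks u using (Tree-suc; Tree⇒¬Strong)
  open Defects u
  open Factors u

  double-length : ∀ x → length x + length x ≤ length (π x)
  double-length [] = z≤n
  double-length (c ∷ x) = begin
    suc (length x + suc (length x))     ≡⟨ cong suc (+-suc (length x) (length x)) ⟩
    2 + (length x + length x)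
      ≤⟨ +-mono-≤ (distinct⇒2≤length {x = zero} {suc zero} (λ ()) (full c zero) (full c (suc zero))) (double-length x) ⟩
    length (π [ c ]) + length (π x)     ≡⟨ sym (trans (cong length (∷-homo c x)) (length-++ (π [ c ]))) ⟩
    length (π (c ∷ x))                  ∎
    where open ≤-Reasoning

  length≤ : ∀ x → length x ≤ length (π x)
  length≤ x = ≤-trans (m≤m+n _ _) (double-length x)

  full-word : ∀ x → 0 < length x → ∀ b → b ∈ π x
  full-word (c ∷ x) _ b = subst (b ∈_) (sym (∷-homo c x)) (∈-++⁺ˡ (full c b))

  -- `C` commutes with every image, so for a prefix `u 0 ∷ y` the word `π y` occurs both at 0 and at
  -- `length C`.
  commuting⇒periodic : π [ zero ] ++ π [ suc zero ] ≡ π [ suc zero ] ++ π [ zero ] → IsPeriodic u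
  commuting⇒periodic AB≡BA = length C , C>0 , periodic
    where
    C = π [ u 0 ]
    C>0 : 0 < length C
    C>0 = ≤-trans (s≤s z≤n) (double-length [ u 0 ])
    letters : ∀ c d → π [ c ] ++ π [ d ] ≡ π [ d ] ++ π [ c ]
    letters zero zero = refl
    letters zero (suc zero) = AB≡BA
    letters (suc zero) zero = sym AB≡BA
    letters (suc zero) (suc zero) = refl
    commute : ∀ x → C ++ π x ≡ π x ++ C
    commute [] = trans (cong (C ++_) ε-homo) (trans (++-identityʳ C) (cong (_++ C) (sym ε-homo)))
    commute (c ∷ x) = begin
      C ++ π (c ∷ x)          ≡⟨ cong (C ++_) (∷-homo c x) ⟩
      C ++ π [ c ] ++ π x     ≡⟨ sym (++-assoc C (π [ c ]) (π x)) ⟩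
      (C ++ π [ c ]) ++ π x   ≡⟨ cong (_++ π x) (letters (u 0) c) ⟩
      (π [ c ] ++ C) ++ π x   ≡⟨ ++-assoc (π [ c ]) C (π x) ⟩
      π [ c ] ++ C ++ π x     ≡⟨ cong (π [ c ] ++_) (commute x) ⟩
      π [ c ] ++ π x ++ C     ≡⟨ sym (++-assoc (π [ c ]) (π x) C) ⟩
      (π [ c ] ++ π x) ++ C   ≡⟨ cong (_++ C) (sym (∷-homo c x)) ⟩
      π (c ∷ x) ++ C          ∎
      where open ≡-Reasoning
    periodic : ∀ n → u (n + length C) ≡ u n
    periodic n with stable (suc (suc n))
    ... | N , e = trans (cong u (+-comm n (length C))) (sym (factorAt⇒Eqv {0} {length (π y)} {length C} (trans (sym atStart) later) n n<))
      where
      y = factorAt u 1 (suc n)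
      whole : prefix u N ≡ C ++ π y
      whole = trans (sym e) (∷-homo (u 0) y)
      later : π y ≡ factorAt u (length C) (length (π y))
      later = proj₂ (factorAt-split 0 N C whole)
      atStart : π y ≡ factorAt u 0 (length (π y))
      atStart = proj₁ (factorAt-split 0 N (π y) (trans whole (commute y)))
      n< : n < length (π y)
      n< = ≤-trans (≤-reflexive (sym (length-factorAt 1 (suc n)))) (length≤ y)

  -- Prefixes recurring arbitrarily late: a letter by fullness, and then the
  -- images under π of recurring prefixes.
  recurring-prefix : ∀ K → ∃ λ N → K < N × (∀ t → ∃ λ j → t ≤ j × Eqv 0 j N)
  recurring-prefix zero = 1 , s≤s z≤n , first
    where
    first : ∀ t → ∃ λ j → t ≤ j × Eqv 0 j 1
    first t with stable (t + 1) | ∈-∃++ (full (u t) (u 0))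
    ... | N , e | as , bs , e′ = length (π (prefix u t) ++ as) , t≤ , λ { zero _ → at ; (suc _) (s≤s ()) }
      where
      whole : prefix u N ≡ (π (prefix u t) ++ as) ++ u 0 ∷ bs
      whole = trans (sym e) (trans (cong π (trans (factorAt-+ 0 t 1) (cong (λ z → prefix u t ++ [ u z ]) (+-identityʳ t))))
        (trans (++-homo (prefix u t) [ u t ]) (trans (cong (π (prefix u t) ++_) e′) (sym (++-assoc (π (prefix u t)) as (u 0 ∷ bs))))))
      at : u 0 ≡ u (length (π (prefix u t) ++ as) + 0)
      at = trans (letterAt 0 N (π (prefix u t) ++ as) whole) (cong u (sym (+-identityʳ _)))
      t≤ : t ≤ length (π (prefix u t) ++ as)
      t≤ = ≤-trans (≤-reflexive (sym (length-factorAt 0 t))) (≤-trans (length≤ (prefix u t))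
             (≤-trans (m≤m+n _ (length as)) (≤-reflexive (sym (length-++ (π (prefix u t)))))))
  recurring-prefix (suc K) with recurring-prefix K
  ... | N , K<N , late with stable N
  ...   | N′ , e = N′ , grows , next
    where
    |π| : length (π (prefix u N)) ≡ N′
    |π| = trans (cong length e) (length-factorAt 0 N′)
    grows : suc K < N′
    grows = ≤-trans (≤-trans (s≤s K<N) (≤-trans (+-monoˡ-≤ N (≤-trans (s≤s z≤n) K<N))
      (≤-reflexive (sym (cong₂ _+_ (length-factorAt 0 N) (length-factorAt 0 N)))))) (≤-trans (double-length (prefix u N)) (≤-reflexive |π|))
    next : ∀ t → ∃ λ j → t ≤ j × Eqv 0 j N′
    next t with late t
    ... | j , t≤j , h with stable (j + N)
    ...   | M , e₂ = length (π (prefix u j)) , ≤-trans t≤j (≤-trans (≤-reflexive (sym (length-factorAt 0 j))) (length≤ (prefix u j))) ,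
                     factorAt⇒Eqv (trans (sym e) (trans later (cong (factorAt u (length (π (prefix u j)))) |π|)))
      where
      later : π (prefix u N) ≡ factorAt u (length (π (prefix u j))) (length (π (prefix u N)))
      later = proj₂ (factorAt-split 0 M (π (prefix u j)) (trans (sym e₂) (trans (cong π (factorAt-+ 0 j N))
        (trans (++-homo (prefix u j) (factorAt u j N)) (cong (λ z → π (prefix u j) ++ π z) (sym (Eqv⇒factorAt h)))))))

  recurrent : Recurrent
  recurrent i n t with recurring-prefix (i + n)
  ... | N , in<N , late with late t
  ...   | j , t≤j , h = j + i , ≤-trans t≤j (m≤m+n j i) , Eqv-drop i (<⇒≤ in<N) h

  module Noncommuting (M : Marked π) (M′ : Marked (mirror π)) where
    open Lift M M′
    open Marked M using (v; mark; mark-inj; v-prefix-long)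

    -- By recurrence the extension of `w` occurs at some `j ≥ length v′`: the image of what precedes
    -- it then ends with `reverse v′`, and the image of the next `length v` letters starts with `v`,
    -- so the whole lift appears in `u`.
    lift-strong : ∀ w → StrongWord w → StrongWord (lift w)
    lift-strong w s c′ d′ with preimage M′.mark M′.mark-inj c′ | preimage mark mark-inj d′
    ... | c , refl | d , refl with s c d
    ...   | i , n , e with recurrent i n (length v′)
    ...     | j , v′≤j , h with stable (j + (n + length v)) | lift-extend c d w
    ...       | N , eN | l , r₂ , eL = infix-IsFactorOf (reverse r′ ++ l) core {r₂ ++ r} (0 , N , (begin
                  (reverse r′ ++ l) ++ core ++ r₂ ++ r           ≡⟨ ++-assoc (reverse r′) l _ ⟩
                  reverse r′ ++ l ++ core ++ r₂ ++ r
                    ≡⟨ cong (reverse r′ ++_) (trans (cong (l ++_) (sym (++-assoc core r₂ r))) (sym (++-assoc l (core ++ r₂) r))) ⟩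
                  reverse r′ ++ (l ++ core ++ r₂) ++ r           ≡⟨ cong (λ x → reverse r′ ++ x ++ r) (sym eL) ⟩
                  reverse r′ ++ lift y ++ r
                    ≡⟨ cong (reverse r′ ++_) (trans (++-assoc (reverse v′) (π y ++ v) r) (cong (reverse v′ ++_) (++-assoc (π y) v r))) ⟩
                  reverse r′ ++ reverse v′ ++ π y ++ v ++ r      ≡⟨ sym (++-assoc (reverse r′) (reverse v′) _) ⟩
                  (reverse r′ ++ reverse v′) ++ π y ++ v ++ r
                    ≡⟨ cong₂ (λ x x′ → x ++ π y ++ x′) (sym πp≡) (sym (proj₂ right)) ⟩
                  π p ++ π y ++ π z
                    ≡⟨ sym (trans (++-homo p (y ++ z)) (cong (π p ++_) (++-homo y z))) ⟩
                  π (p ++ y ++ z)                                ≡⟨ cong π (sym pyz) ⟩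
                  π (prefix u (j + (n + length v)))              ≡⟨ eN ⟩
                  prefix u N                                     ∎))
      where
      open ≡-Reasoning
      core = M′.mark c ∷ lift w ++ [ mark d ]
      y = c ∷ w ++ [ d ]
      p = prefix u j
      z = factorAt u (j + n) (length v)
      pyz : prefix u (j + (n + length v)) ≡ p ++ y ++ z
      pyz = trans (factorAt-+ 0 j (n + length v)) (cong (p ++_) (trans (factorAt-+ j n (length v))
              (cong (_++ z) (trans (sym (Eqv⇒factorAt h)) (sym e)))))
      right : ∃ λ r → π z ≡ v ++ r
      right = v-prefix-long z (≤-trans (≤-reflexive (sym (length-factorAt (j + n) (length v)))) (length≤ z))
      r = proj₁ right
      mirror-p : mirror π (reverse p) ≡ reverse (π p)
      mirror-p = cong (λ x → reverse (π x)) (reverse-involutive p)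
      left : ∃ λ r → mirror π (reverse p) ≡ v′ ++ r
      left = M′.v-prefix-long (reverse p) (≤-trans v′≤j (≤-trans (≤-reflexive (sym (length-factorAt 0 j)))
               (≤-trans (length≤ p) (≤-reflexive (sym (trans (cong length mirror-p) (length-reverse (π p))))))))
      r′ = proj₁ left
      πp≡ : π p ≡ reverse r′ ++ reverse v′
      πp≡ = trans (sym (reverse-involutive (π p))) (trans (cong reverse (trans (sym mirror-p) (proj₂ left))) (reverse-++ v′ r′))

    lifts : ℕ → Word 2 → Word 2
    lifts zero    w = w
    lifts (suc k) w = lift (lifts k w)

    lifts-strong : ∀ k w → StrongWord w → StrongWord (lifts k w)
    lifts-strong zero    w s = s
    lifts-strong (suc k) w s = lift-strong (lifts k w) (lifts-strong k w s)

    lift-longer : ∀ x → length (π x) ≤ length (lift x)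
    lift-longer x = ≤-trans (m≤m+n (length (π x)) (length v)) (≤-trans (m≤n+m _ (length (reverse v′)))
      (≤-reflexive (sym (trans (length-++ (reverse v′)) (cong (length (reverse v′) +_) (length-++ (π x)))))))

    lifts-long : ∀ k w → 0 < length w → k < length (lifts k w)
    lifts-long zero    w 0<w = 0<w
    lifts-long (suc k) w 0<w = ≤-trans (≤-trans (s≤s k<) (+-monoˡ-≤ _ (≤-trans (s≤s z≤n) k<)))
      (≤-trans (double-length (lifts k w)) (lift-longer (lifts k w)))
      where k< = lifts-long k w 0<w

    strong⇒palindrome : ∀ n₀ → (∀ w → n₀ ≤ length w → StrongWord w → IsPalindrome w) →
      ∀ w → StrongWord w → IsPalindrome w
    strong⇒palindrome n₀ long [] s = refl
    strong⇒palindrome n₀ long w@(_ ∷ _) s = descend (suc n₀) palx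
      where
      0<w : 0 < length w
      0<w = s≤s z≤n
      -- This many lifts of a non-empty word exceed length `n₀`, and at least one is needed for `x`
      -- to contain both letters.
      x = lifts (suc n₀) w
      n₀<x : suc n₀ < length x
      n₀<x = lifts-long (suc n₀) w 0<w
      palx : IsPalindrome x
      palx = long x (<⇒≤ (<-trans (n<1+n n₀) n₀<x)) (lifts-strong (suc n₀) w s)
      palLx : IsPalindrome (lift x)
      palLx = long (lift x) (≤-trans (n≤1+n n₀) (<⇒≤ (<-trans (n<1+n (suc n₀)) (lifts-long (suc (suc n₀)) w 0<w)))) (lifts-strong (suc (suc n₀)) w s)
      all : ∀ c → c ∈ x
      all c = ∈-++⁺ʳ (reverse v′) (∈-++⁺ˡ (full-word (lifts n₀ w) (≤-trans (s≤s z≤n) (lifts-long n₀ w 0<w)) c))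
      commutes : ∀ y → reverse (lift y) ≡ lift (reverse y)
      commutes = lift-reverse x all (≤-trans (s≤s z≤n) n₀<x) palx palLx
      descend : ∀ k → IsPalindrome (lifts k w) → IsPalindrome w
      descend zero    p = p
      descend (suc k) p = descend k (lift-injective _ _ (trans (sym (commutes (lifts k w))) p))

    all-PalReturns : ∀ n₀ → (∀ n → n₀ ≤ n → NewPalSuffix n) → ∀ n → PalReturns n
    all-PalReturns n₀ new = Tree⇒PalReturns tree
      where
      longTree : ∀ n → n₀ ≤ n → Tree n
      longTree n n₀≤n = PalReturns⇒Tree (NewPalSuffix⇒PalReturns n₀ new n n₀≤n)
      long : ∀ w → n₀ ≤ length w → StrongWord w → IsPalindrome w
      long w n₀≤w s = subst IsPalindrome (sym w≡) (Mir⇒reverse (decidable-stable (Mir? t t (length w))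
          λ ¬pal → Tree⇒¬Strong (longTree (suc (length w)) (m≤n⇒m≤1+n n₀≤w)) t ¬pal
            (StrongWord⇒Strong (subst StrongWord w≡ s))))
        where
        occurrence = infix-IsFactorOf [ zero ] w (s zero zero)
        t = proj₁ occurrence
        w≡ : w ≡ factorAt u t (length w)
        w≡ = trans (proj₂ (proj₂ occurrence)) (cong (factorAt u t) (sym (trans (cong length (proj₂ (proj₂ occurrence))) (length-factorAt t _))))
      noStrong : ∀ n t → ¬ Mir t t n → ¬ Strong t n
      noStrong n t ¬pal s = ¬pal (reverse⇒Mir (strong⇒palindrome n₀ long (factorAt u t n) (Strong⇒StrongWord s)))
      tree : ∀ n → Tree n
      -- At order 0 the edges are single letters, hence palindromes and loops.
      tree zero p ¬pal i j c = contradiction (λ { zero zero refl → refl }) ¬pal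
      tree (suc n) = Tree-suc (NewPalSuffix⇒MirrorClosed n₀ new recurrent) (noStrong n) (tree n)

    finite-defect⇒0 : HasFiniteDefect u → HasDefect u 0
    finite-defect⇒0 fin = bound , λ _ _ → z≤n
      where
      bound : IsDefectBound u 0
      bound w (i , n , refl) = decidable-stable (defect w ≤? 0) λ ¬0 → finite-defect⇒new fin λ (n₀ , new) →
        ¬0 (Shifted.new⇒defect-0 (Shifted.PalReturns⇒new (λ n → Shift.shift-PalReturns u i (all-PalReturns n₀ new n))) n)
        where module Shifted = Defects (λ j → u (i + j))

  dichotomy : HasFiniteDefect u → HasDefect u 0 ⊎ IsPeriodic u
  dichotomy fin with (π [ zero ] ++ π [ suc zero ]) ≟ʷ (π [ suc zero ] ++ π [ zero ])
  ... | yes e = inj₂ (commuting⇒periodic e)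
  ... | no ¬e = inj₁ (Noncommuting.finite-defect⇒0 (noncommuting⇒Marked hom ¬e)
          (noncommuting⇒Marked (mirror-Hom hom) ¬e′) fin)
    where
    ¬e′ : mirror π [ zero ] ++ mirror π [ suc zero ] ≢ mirror π [ suc zero ] ++ mirror π [ zero ]
    ¬e′ e′ = ¬e (sym (reverse-injective (trans (reverse-++ (π [ suc zero ]) (π [ zero ]))
      (trans e′ (sym (reverse-++ (π [ zero ]) (π [ suc zero ])))))))

theorem24 : (φ : Word 2 → Word 2) → IsMorphism φ → IsPrimitive φ →
    (u : InfWord 2) → IsFixedPoint φ u →
    HasFiniteDefect u → HasDefect u 0 ⊎ IsPeriodic u
theorem24 φ morphism (m , full) u (fixed , _) = Expanding.dichotomy (power-Hom m) full u (power-stable m)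
  where
  open MonoidMorphisms.IsMonoidHomomorphism morphism using (homo; ε-homo)
  open Endo (Word 2) using (_^_)
  power-Hom : ∀ m → Hom (φ ^ m)
  power-Hom zero    = record { ε-homo = refl ; ++-homo = λ _ _ → refl }
  power-Hom (suc m) = record
    { ε-homo  = trans (cong φ (Hom.ε-homo (power-Hom m))) ε-homo
    ; ++-homo = λ x y → trans (cong φ (Hom.++-homo (power-Hom m) x y)) (homo _ _)
    }
  power-stable : ∀ m n → ∃ λ N → (φ ^ m) (prefix u n) ≡ prefix u N
  power-stable zero    n = n , refl
  power-stable (suc m) n with power-stable m n
  ... | N , e = _ , trans (cong φ e) (fixed N)
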